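{- Let $\mathcal{O}$ be a decomposable set of Scott-open modalities. Then the open extensions of the behavioural equivalence $\equiv_{\mathcal{V}}$ and of the positive behavioural preorder $\sqsubseteq_{\mathcal{V}^+}$ are both compatible. (Consequently the open extension of $\equiv_{\mathcal{V}^+}$ is also compatible.)
   Context: Language: types $\tau ::= \mathbf{1} \mid \mathbf{N} \mid \tau \to \tau'$. A signature $\Sigma$ of effect operations is fixed, each $\sigma\in\Sigma$ having an arity of one of the forms $\alpha^n\to\alpha$, $\mathbf{N}\times\alpha^n\to\alpha$, $\alpha^{\mathbf{N}}\to\alpha$, $\mathbf{N}\times\alpha^{\mathbf{N}}\to\alpha$. Values $V,W ::= * \mid Z \mid S(V) \mid \lambda x{:}\tau.M \mid x$; computations $M,N ::= VW \mid \mathbf{return}\,V \mid \mathbf{let}\ M\Rightarrow x\ \mathbf{in}\ N \mid \mathbf{fix}(V) \mid \mathbf{case}\ V\ \mathbf{of}\ \{Z\Rightarrow M; S(x)\Rightarrow N\} \mid \sigma(M_0,\dots,M_{n-1}) \mid \sigma(V;M_0,\dots,M_{n-1}) \mid \sigma(V) \mid \sigma(V;W)$, simply typed in the standard call-by-value way ($\mathbf{fix}(V):\tau\to\tau'$ for $V:(\tau\to\tau')\to(\tau\to\tau')$; numeric first arguments of effect operations have type $\mathbf{N}$; in $\sigma(V)$, $\sigma(W;V)$ the argument $V$ has type $\mathbf{N}\to\tau$; the $M_i$ have the result type). $\mathit{Val}(\tau)$, $\mathit{Com}(\tau)$ are the closed values/computations of type $\tau$; $\overline{n}=S^n(Z)$.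 Effect trees: for a set $X$, $TX$ is the set of possibly infinite labelled trees whose leaves are labelled $\bot$ or by elements of $X$ and whose internal nodes are labelled by some $\sigma$ (with $n$ children for arity $\alpha^n\to\alpha$, $\mathbb{N}$-indexed children for $\alpha^{\mathbf{N}}\to\alpha$) or by $\sigma_m$, $m\in\mathbb{N}$ (for the arities $\mathbf{N}\times\alpha^n\to\alpha$, $\mathbf{N}\times\alpha^{\mathbf{N}}\to\alpha$). $t\le t'$ iff $t$ is obtained from $t'$ by replacing some subtrees by $\bot$-leaves; this is an $\omega$-cpo. Each $M\in\mathit{Com}(\tau)$ has an effect tree $|M|\in T(\mathit{Val}(\tau))$ given by call-by-value evaluation ($\beta$, case reduction, $\mathbf{fix}(F)$ reducing to $\mathbf{return}\ \lambda x.\mathbf{let}\ F(\lambda y.\mathbf{let}\ \mathbf{fix}\,F\Rightarrow z\ \mathbf{in}\ zy)\Rightarrow w\ \mathbf{in}\ wx$, let-sequencing): termination with $\mathbf{return}\,V$ gives the leaf $V$, reaching an effect operation gives a node labelled by it whose children are the trees of the continuations (for $\sigma(V)$: of $V\overline{0},V\overline{1},\dots$), divergence gives $\bot$; formally $|M|$ is the supremum of its finite-step approximations. Modalities: a set $\mathcal{O}$ with an interpretation $[\![o]\!]\subseteq T\mathbf{1}$ for each $o$ ($\mathbf{1}=\{*\}$). For $t\in TX$, $P\subseteq X$, $t[\in P]\in T\mathbf{1}$ replaces leaves in $P$ by $*$ and other $X$-leaves by $\bot$; $o(A)=\{t\in TX\mid t[\in A]\in[\![o]\!]\}$. $o$ is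 upwards closed if $[\![o]\!]$ is upward closed for $\le$; Scott-open if moreover, whenever $t_1\le t_2\le\dots$ has supremum in $[\![o]\!]$, some $t_n\in[\![o]\!]$. Logic $\mathcal{V}$: value formulas $VF(\tau)$ and computation formulas $CF(\tau)$: $\{n\}\in VF(\mathbf{N})$; $(V\mapsto\Phi)\in VF(\tau\to\tau')$ for $V\in\mathit{Val}(\tau)$, $\Phi\in CF(\tau')$; $o\,\phi\in CF(\tau)$ for $o\in\mathcal{O}$, $\phi\in VF(\tau)$; both closed under arbitrary $\bigwedge$, $\bigvee$, $\neg$. Semantics: $W\models\{n\}$ iff $W=\overline{n}$; $W\models(V\mapsto\Phi)$ iff $WV\models\Phi$; $M\models o\,\phi$ iff $|M|[\in\{V\mid V\models\phi\}]\in[\![o]\!]$; connectives classical. $\mathcal{V}^+$ is the negation-free fragment. For a fragment $\mathcal{L}$, $V\sqsubseteq_{\mathcal{L}}W$ iff every value formula of $\mathcal{L}$ satisfied by $V$ is satisfied by $W$ (same for computations, same type); $\equiv_{\mathcal{L}}$ is $\sqsubseteq_{\mathcal{L}}\cap\sqsupseteq_{\mathcal{L}}$. Decomposability: let $\mathcal{T}$ be the smallest class containing formulas $o(\top)$, $o(\bot)$ ($o\in\mathcal{O}$), closed under arbitrary $\bigvee,\bigwedge$, with $[\![o(\top)]\!]=o(\{*\})$, $[\![o(\bot)]\!]=o(\emptyset)$, unions/intersections for $\bigvee/\bigwedge$. For $t,t'\in T\mathbf{1}$: $t\trianglelefteq t'$ iff $\forall\Phi\in\mathcal{T}$, $t\in[\![\Phi]\!]\Rightarrow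 t'\in[\![\Phi]\!]$. For $r,r'\in TT\mathbf{1}$: $r\preccurlyeq r'$ iff $\forall o\in\mathcal{O}\,\forall\Phi\in\mathcal{T}$, $r\in o([\![\Phi]\!])\Rightarrow r'\in o([\![\Phi]\!])$. $\mu:TT\mathbf{1}\to T\mathbf{1}$ flattens a tree of trees. $\mathcal{O}$ is decomposable if $r\preccurlyeq r'$ implies $\mu r\trianglelefteq\mu r'$. Open extension and compatibility: for a relation $R$ on closed terms of equal type and aspect, $\Gamma\vdash M\,R^\circ\,N$ iff $M[\vec V/\vec x]\,R\,N[\vec V/\vec x]$ for all closed values $\vec V$ instantiating $\Gamma$. An open relation is compatible if it relates each variable to itself and is closed under every term constructor (Z, S, return, $\lambda$, application, fix, case, let, each effect operation): terms built by the same constructor from related immediate subterms (in the context extended by bound variables) are related. -}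

module Defs where

open import Level using (Level; 0ℓ; Setω) renaming (suc to lsuc)
open import Axiom.ExcludedMiddle using (ExcludedMiddle)
open import Data.Fin using (Fin)
open import Data.List using (List; []; _∷_; _++_)
open import Data.Nat using (ℕ; zero; suc)
import Data.Nat as ℕ
import Data.Nat.Properties as ℕ
open import Data.Product using (Σ; ∃-syntax; _×_; _,_)
open import Data.Sum using (inj₁; inj₂)
open import Data.Unit using (⊤; tt)
open import Data.Vec using (Vec; []; _∷_; lookup)
open import Data.Vec.Relation.Binary.Pointwise.Inductive using (Pointwise)
open import Relation.Binary using (Rel; _Respects_)
open import Relation.Binary.PropositionalEquality
  using (_≡_; _≢_; refl; sym; trans; cong; subst)
open import Relation.Nullary using (¬_; yes; no; contradiction)
open import Relation.Unary using (Pred; _∈_; ∅; U)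

private
  variable
    ℓ : Level
    X : Set

-- Excluded middle at every universe level.  It is an assumption of the
-- development because Agda is constructive: convergence of programs and
-- membership in arbitrary sets of leaves are decided with it.
Classical : Setω
Classical = ∀ {ℓ} → ExcludedMiddle ℓ

infixr 7 _⇒_
infix  4 _∋_

data Ty : Set where
  𝟙 N : Ty
  _⇒_ : Ty → Ty → Ty

Ctx : Set
Ctx = List Ty

data _∋_ : Ctx → Ty → Set where
  z : ∀ {Γ τ} → τ ∷ Γ ∋ τ
  s : ∀ {Γ τ τ′} → Γ ∋ τ → τ′ ∷ Γ ∋ τ

data Arity : Set where
  α^_⇒α   : ℕ → Arity
  N×α^_⇒α : ℕ → Arity
  α^N⇒α   : Arity
  N×α^N⇒α : Arity

-- The effect operations, sorted by arity.
Signature : Set₁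
Signature = Arity → Set

data Aspect : Set where
  val com : Aspect

module Language (Op : Signature) where

  infix 8 _·_

  mutual
    Val Com : Ctx → Ty → Set
    Val = Term val
    Com = Term com

    data Term : Aspect → Ctx → Ty → Set where
      ⋆       : ∀ {Γ} → Val Γ 𝟙
      Z       : ∀ {Γ} → Val Γ N
      S       : ∀ {Γ} → Val Γ N → Val Γ N
      ƛ       : ∀ {Γ τ τ′} → Com (τ ∷ Γ) τ′ → Val Γ (τ ⇒ τ′)
      var     : ∀ {Γ τ} → Γ ∋ τ → Val Γ τ
      _·_     : ∀ {Γ τ τ′} → Val Γ (τ ⇒ τ′) → Val Γ τ → Com Γ τ′
      return  : ∀ {Γ τ} → Val Γ τ → Com Γ τ
      letin   : ∀ {Γ τ τ′} → Com Γ τ → Com (τ ∷ Γ) τ′ → Com Γ τ′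
      fix     : ∀ {Γ τ τ′} → Val Γ ((τ ⇒ τ′) ⇒ (τ ⇒ τ′)) → Com Γ (τ ⇒ τ′)
      case    : ∀ {Γ τ} → Val Γ N → Com Γ τ → Com (N ∷ Γ) τ → Com Γ τ
      opFin   : ∀ {Γ τ n} → Op α^ n ⇒α → Vec (Com Γ τ) n → Com Γ τ
      opNFin  : ∀ {Γ τ n} → Op N×α^ n ⇒α → Val Γ N → Vec (Com Γ τ) n → Com Γ τ
      opNat   : ∀ {Γ τ} → Op α^N⇒α → Val Γ (N ⇒ τ) → Com Γ τ
      opNNat  : ∀ {Γ τ} → Op N×α^N⇒α → Val Γ N → Val Γ (N ⇒ τ) → Com Γ τ

  Ren Sub : Ctx → Ctx → Set
  Ren Γ Δ = ∀ {τ} → Γ ∋ τ → Δ ∋ τ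
  Sub Γ Δ = ∀ {τ} → Γ ∋ τ → Val Δ τ

  liftRen : ∀ {Γ Δ τ} → Ren Γ Δ → Ren (τ ∷ Γ) (τ ∷ Δ)
  liftRen ρ z     = z
  liftRen ρ (s x) = s (ρ x)

  mutual
    rename : ∀ {a Γ Δ τ} → Ren Γ Δ → Term a Γ τ → Term a Δ τ
    rename ρ ⋆               = ⋆
    rename ρ Z               = Z
    rename ρ (S V)           = S (rename ρ V)
    rename ρ (ƛ M)           = ƛ (rename (liftRen ρ) M)
    rename ρ (var x)         = var (ρ x)
    rename ρ (V · W)         = rename ρ V · rename ρ W
    rename ρ (return V)      = return (rename ρ V)
    rename ρ (letin M M′)    = letin (rename ρ M) (rename (liftRen ρ) M′)
    rename ρ (fix V)         = fix (rename ρ V)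
    rename ρ (case V M M′)   = case (rename ρ V) (rename ρ M) (rename (liftRen ρ) M′)
    rename ρ (opFin σ Ms)    = opFin σ (renames ρ Ms)
    rename ρ (opNFin σ V Ms) = opNFin σ (rename ρ V) (renames ρ Ms)
    rename ρ (opNat σ V)     = opNat σ (rename ρ V)
    rename ρ (opNNat σ V W)  = opNNat σ (rename ρ V) (rename ρ W)

    renames : ∀ {a Γ Δ τ n} → Ren Γ Δ → Vec (Term a Γ τ) n → Vec (Term a Δ τ) n
    renames ρ []       = []
    renames ρ (M ∷ Ms) = rename ρ M ∷ renames ρ Ms

  weaken : ∀ {a Γ τ τ′} → Term a Γ τ → Term a (τ′ ∷ Γ) τ
  weaken = rename s

  liftSub : ∀ {Γ Δ τ} → Sub Γ Δ → Sub (τ ∷ Γ) (τ ∷ Δ)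
  liftSub θ z     = var z
  liftSub θ (s x) = weaken (θ x)

  mutual
    sub : ∀ {a Γ Δ τ} → Sub Γ Δ → Term a Γ τ → Term a Δ τ
    sub θ ⋆               = ⋆
    sub θ Z               = Z
    sub θ (S V)           = S (sub θ V)
    sub θ (ƛ M)           = ƛ (sub (liftSub θ) M)
    sub θ (var x)         = θ x
    sub θ (V · W)         = sub θ V · sub θ W
    sub θ (return V)      = return (sub θ V)
    sub θ (letin M M′)    = letin (sub θ M) (sub (liftSub θ) M′)
    sub θ (fix V)         = fix (sub θ V)
    sub θ (case V M M′)   = case (sub θ V) (sub θ M) (sub (liftSub θ) M′)
    sub θ (opFin σ Ms)    = opFin σ (subs θ Ms)
    sub θ (opNFin σ V Ms) = opNFin σ (sub θ V) (subs θ Ms)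
    sub θ (opNat σ V)     = opNat σ (sub θ V)
    sub θ (opNNat σ V W)  = opNNat σ (sub θ V) (sub θ W)

    subs : ∀ {a Γ Δ τ n} → Sub Γ Δ → Vec (Term a Γ τ) n → Vec (Term a Δ τ) n
    subs θ []       = []
    subs θ (M ∷ Ms) = sub θ M ∷ subs θ Ms

  single : ∀ {Γ τ} → Val Γ τ → Sub (τ ∷ Γ) Γ
  single V z     = V
  single V (s x) = var x

  infix 9 _[_]
  _[_] : ∀ {a Γ τ τ′} → Term a (τ ∷ Γ) τ′ → Val Γ τ → Term a Γ τ′
  M [ V ] = sub (single V) M

  numeral : ∀ {Γ} → ℕ → Val Γ N
  numeral zero    = Z
  numeral (suc n) = S (numeral n)

  toℕ : Val [] N → ℕ
  toℕ Z     = zero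
  toℕ (S V) = suc (toℕ V)

  -- λx. let F (λy. let fix F ⇒ z in z y) ⇒ w in w x
  unfold : ∀ {Γ τ τ′} → Val Γ ((τ ⇒ τ′) ⇒ (τ ⇒ τ′)) → Val Γ (τ ⇒ τ′)
  unfold F =
    ƛ (letin (weaken F · ƛ (letin (fix (weaken (weaken F))) (var z · var (s z))))
             (var z · var (s z)))

  ClosedRel OpenRel : (ℓ : Level) → Set (lsuc ℓ)
  ClosedRel ℓ = ∀ {a τ} → Rel (Term a [] τ) ℓ
  OpenRel   ℓ = ∀ {a Γ τ} → Rel (Term a Γ τ) ℓ

  infix 10 _°
  _° : ClosedRel ℓ → OpenRel ℓ
  (R °) {Γ = Γ} M M′ = (θ : Sub Γ []) → R (sub θ M) (sub θ M′)

  record Compatible (R : OpenRel ℓ) : Set ℓ where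
    field
      ⋆-compat      : ∀ {Γ} → R {Γ = Γ} ⋆ ⋆
      Z-compat      : ∀ {Γ} → R {Γ = Γ} Z Z
      S-compat      : ∀ {Γ} {V V′ : Val Γ N} → R V V′ → R (S V) (S V′)
      ƛ-compat      : ∀ {Γ τ τ′} {M M′ : Com (τ ∷ Γ) τ′} → R M M′ → R (ƛ M) (ƛ M′)
      var-compat    : ∀ {Γ τ} (x : Γ ∋ τ) → R (var x) (var x)
      ·-compat      : ∀ {Γ τ τ′} {V V′ : Val Γ (τ ⇒ τ′)} {W W′ : Val Γ τ} →
                      R V V′ → R W W′ → R (V · W) (V′ · W′)
      return-compat : ∀ {Γ τ} {V V′ : Val Γ τ} → R V V′ → R (return V) (return V′)
      let-compat    : ∀ {Γ τ τ′} {M M′ : Com Γ τ} {L L′ : Com (τ ∷ Γ) τ′} →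
                      R M M′ → R L L′ → R (letin M L) (letin M′ L′)
      fix-compat    : ∀ {Γ τ τ′} {V V′ : Val Γ ((τ ⇒ τ′) ⇒ (τ ⇒ τ′))} →
                      R V V′ → R (fix V) (fix V′)
      case-compat   : ∀ {Γ τ} {V V′ : Val Γ N} {M M′ : Com Γ τ} {L L′ : Com (N ∷ Γ) τ} →
                      R V V′ → R M M′ → R L L′ → R (case V M L) (case V′ M′ L′)
      opFin-compat  : ∀ {Γ τ n} (σ : Op α^ n ⇒α) {Ms Ms′ : Vec (Com Γ τ) n} →
                      Pointwise R Ms Ms′ → R (opFin σ Ms) (opFin σ Ms′)
      opNFin-compat : ∀ {Γ τ n} (σ : Op N×α^ n ⇒α) {V V′ : Val Γ N}
                      {Ms Ms′ : Vec (Com Γ τ) n} →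
                      R V V′ → Pointwise R Ms Ms′ → R (opNFin σ V Ms) (opNFin σ V′ Ms′)
      opNat-compat  : ∀ {Γ τ} (σ : Op α^N⇒α) {V V′ : Val Γ (N ⇒ τ)} →
                      R V V′ → R (opNat σ V) (opNat σ V′)
      opNNat-compat : ∀ {Γ τ} (σ : Op N×α^N⇒α) {V V′ : Val Γ N} {W W′ : Val Γ (N ⇒ τ)} →
                      R V V′ → R W W′ → R (opNNat σ V W) (opNNat σ V′ W′)

module Trees (Op : Signature) where

  data Label : Set where
    fin  : ∀ {n} → Op α^ n ⇒α → Label
    Nfin : ∀ {n} → Op N×α^ n ⇒α → ℕ → Label
    nat  : Op α^N⇒α → Label
    Nnat : Op N×α^N⇒α → ℕ → Label

  Branch : Label → Set
  Branch (fin {n} _)    = Fin n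
  Branch (Nfin {n} _ _) = Fin n
  Branch (nat _)        = ℕ
  Branch (Nnat _ _)     = ℕ

  -- A position in a tree, given by the labels of the nodes passed on the
  -- way down from the root together with the branch taken at each of them.
  Path : Set
  Path = List (Σ Label Branch)

  data Shape (X : Set) : Set where
    bot  : Shape X
    leaf : X → Shape X
    node : Label → Shape X

  -- A possibly infinite tree is the function giving what is found at each
  -- path, where `bot` is given both at ⊥-leaves and at paths that are not in
  -- the tree.  By `coherent`, only paths through actual nodes of the tree can
  -- lead to anything else, so that each tree has, up to `_≈_`, one such
  -- function.
  record Tree (X : Set) : Set where
    field
      at       : Path → Shape X
      coherent : ∀ p ν (b : Branch ν) q → at (p ++ (ν , b) ∷ q) ≢ bot → at p ≡ node ν
  open Tree public

  infix 4 _≤ˢ_ _≤_ _≈_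

  data _≤ˢ_ {X : Set} : Rel (Shape X) 0ℓ where
    bot≤ : ∀ {x} → bot ≤ˢ x
    refl : ∀ {x} → x ≤ˢ x

  _≤_ _≈_ : Rel (Tree X) 0ℓ
  t ≤ t′ = ∀ p → at t p ≤ˢ at t′ p
  t ≈ t′ = ∀ p → at t p ≡ at t′ p

  IsChain : (ℕ → Tree X) → Set
  IsChain c = ∀ n → c n ≤ c (suc n)

  IsSup : (ℕ → Tree X) → Tree X → Set
  IsSup c t = (∀ n → c n ≤ t) × (∀ u → (∀ n → c n ≤ u) → t ≤ u)

  ≤ˢ-trans : {x y w : Shape X} → x ≤ˢ y → y ≤ˢ w → x ≤ˢ w
  ≤ˢ-trans bot≤ _ = bot≤
  ≤ˢ-trans refl q = q

  ≤ˢ-defined : {x y : Shape X} → x ≤ˢ y → x ≢ bot → y ≡ x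
  ≤ˢ-defined bot≤ d = contradiction refl d
  ≤ˢ-defined refl d = refl

  chain-≤ : (c : ℕ → Tree X) → IsChain c → ∀ {m n} → m ℕ.≤′ n → c m ≤ c n
  chain-≤ c mono ℕ.≤′-refl           p = refl
  chain-≤ c mono (ℕ.≤′-step {n} m≤n) p = ≤ˢ-trans (chain-≤ c mono m≤n p) (mono n p)

  chain-agree : (c : ℕ → Tree X) → IsChain c → ∀ m n p →
                at (c m) p ≢ bot → at (c n) p ≢ bot → at (c m) p ≡ at (c n) p
  chain-agree c mono m n p dm dn with ℕ.≤-total m n
  ... | inj₁ m≤n = sym (≤ˢ-defined (chain-≤ c mono (ℕ.≤⇒≤′ m≤n) p) dm)
  ... | inj₂ n≤m = ≤ˢ-defined (chain-≤ c mono (ℕ.≤⇒≤′ n≤m) p) dn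

  ⊥ᵀ : Tree X
  ⊥ᵀ .at _ = bot
  ⊥ᵀ .coherent p ν b q d = contradiction refl d

  leafᵀ : X → Tree X
  leafᵀ x .at []      = leaf x
  leafᵀ x .at (_ ∷ _) = bot
  leafᵀ x .coherent []      ν b q d = contradiction refl d
  leafᵀ x .coherent (_ ∷ _) ν b q d = contradiction refl d

  flatten : (Path → Shape (Tree X)) → Path → Shape X
  flatten f [] with f []
  ... | bot    = bot
  ... | leaf t = at t []
  ... | node ν = node ν
  flatten f (e ∷ p) with f []
  ... | bot    = bot
  ... | leaf t = at t (e ∷ p)
  ... | node _ = flatten (λ q → f (e ∷ q)) p

  flatten-bot : (f : Path → Shape (Tree X)) → ∀ p → f [] ≡ bot → flatten f p ≡ bot
  flatten-bot f []      eq rewrite eq = refl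
  flatten-bot f (_ ∷ _) eq rewrite eq = refl

  flatten-coherent :
    (f : Path → Shape (Tree X)) →
    (∀ p ν (b : Branch ν) q → f (p ++ (ν , b) ∷ q) ≢ bot → f p ≡ node ν) →
    ∀ p ν (b : Branch ν) q → flatten f (p ++ (ν , b) ∷ q) ≢ bot → flatten f p ≡ node ν
  flatten-coherent f coh [] ν b q d with f [] in eq
  ... | bot    = contradiction refl d
  ... | leaf t = coherent t [] ν b q d
  ... | node _ with trans (sym eq) (coh [] ν b [] λ e → d (flatten-bot (λ p → f ((ν , b) ∷ p)) q e))
  ...   | refl = refl
  flatten-coherent f coh (e ∷ p) ν b q d with f []
  ... | bot    = contradiction refl d
  ... | leaf t = coherent t (e ∷ p) ν b q d
  ... | node _ = flatten-coherent (λ r → f (e ∷ r)) (λ r → coh (e ∷ r)) p ν b q d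

  μ : Tree (Tree X) → Tree X
  μ r .at       = flatten (at r)
  μ r .coherent = flatten-coherent (at r) (coherent r)

  -- Trees are identified up to `_≈_`, whence `resp`.
  record Modalities : Set₁ where
    field
      O    : Set
      ⟦_⟧  : O → Pred (Tree ⊤) 0ℓ
      resp : ∀ o → ⟦ o ⟧ Respects _≈_

  UpwardsClosed : Pred (Tree ⊤) 0ℓ → Set
  UpwardsClosed P = P Respects _≤_

  ScottOpen : Pred (Tree ⊤) 0ℓ → Set
  ScottOpen P =
    UpwardsClosed P ×
    (∀ c → IsChain c → ∀ t → IsSup c t → t ∈ P → ∃[ n ] c n ∈ P)

module Semantics (em : Classical) (Op : Signature) where

  open Language Op
  open Trees Op

  nodeAt : (ν : Label) → (Branch ν → Tree X) → Path → Shape X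
  nodeAt ν k []             = node ν
  nodeAt ν k ((ν′ , b) ∷ p) with em {P = ν′ ≡ ν}
  ... | yes refl = at (k b) p
  ... | no _     = bot

  nodeᵀ : (ν : Label) → (Branch ν → Tree X) → Tree X
  nodeᵀ ν k .at = nodeAt ν k
  nodeᵀ ν k .coherent []             ν₁ b₁ q d with em {P = ν₁ ≡ ν}
  ... | yes refl = refl
  ... | no _     = contradiction refl d
  nodeᵀ ν k .coherent ((ν′ , b) ∷ p) ν₁ b₁ q d with em {P = ν′ ≡ ν}
  ... | yes refl = coherent (k b) p ν₁ b₁ q d
  ... | no _     = contradiction refl d

  nodeᵀ-mono : ∀ ν {k k′ : Branch ν → Tree X} → (∀ b → k b ≤ k′ b) → nodeᵀ ν k ≤ nodeᵀ ν k′
  nodeᵀ-mono ν h []             = refl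
  nodeᵀ-mono ν h ((ν′ , b) ∷ p) with em {P = ν′ ≡ ν}
  ... | yes refl = h b p
  ... | no _     = refl

  ⨆At : (ℕ → Tree X) → Path → Shape X
  ⨆At c p with em {P = ∃[ n ] at (c n) p ≢ bot}
  ... | yes (n , _) = at (c n) p
  ... | no _        = bot

  ⨆At-≡ : (c : ℕ → Tree X) → IsChain c → ∀ n p → at (c n) p ≢ bot → ⨆At c p ≡ at (c n) p
  ⨆At-≡ c mono n p d with em {P = ∃[ m ] at (c m) p ≢ bot}
  ... | yes (m , d′) = chain-agree c mono m n p d′ d
  ... | no ∄         = contradiction (n , d) ∄

  ⨆ : (c : ℕ → Tree X) → IsChain c → Tree X
  ⨆ c mono .at = ⨆At c
  ⨆ c mono .coherent p ν b q d with em {P = ∃[ n ] at (c n) (p ++ (ν , b) ∷ q) ≢ bot}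
  ... | no _         = contradiction refl d
  ... | yes (n , d′) = trans (⨆At-≡ c mono n p λ e → node≢bot (trans (sym eq) e)) eq
    where
    eq : at (c n) p ≡ node ν
    eq = coherent (c n) p ν b q d′
    node≢bot : node ν ≢ bot
    node≢bot ()

  ⨆-isSup : (c : ℕ → Tree X) (mono : IsChain c) → IsSup c (⨆ c mono)
  ⨆-isSup c mono = upper , least
    where
    upper : ∀ n → c n ≤ ⨆ c mono
    upper n p with em {P = at (c n) p ≡ bot}
    ... | yes e rewrite e = bot≤
    ... | no d = subst (at (c n) p ≤ˢ_) (sym (⨆At-≡ c mono n p d)) refl
    least : ∀ u → (∀ n → c n ≤ u) → ⨆ c mono ≤ u
    least u h p with em {P = ∃[ n ] at (c n) p ≢ bot}
    ... | yes (n , _) = h n p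
    ... | no _        = bot≤

  restrict : Pred X ℓ → Shape X → Shape ⊤
  restrict P bot      = bot
  restrict P (leaf x) with em {P = P x}
  ... | yes _ = leaf tt
  ... | no _  = bot
  restrict P (node ν) = node ν

  restrict-defined : (P : Pred X ℓ) (x : Shape X) → restrict P x ≢ bot → x ≢ bot
  restrict-defined P bot d refl = d refl

  infix 20 _[∈_]
  _[∈_] : Tree X → Pred X ℓ → Tree ⊤
  (t [∈ P ]) .at p = restrict P (at t p)
  (t [∈ P ]) .coherent p ν b q d =
    cong (restrict P) (coherent t p ν b q (restrict-defined P _ d))

  data Outcome (τ : Ty) : Set where
    returns  : Val [] τ → Outcome τ
    reduces  : Com [] τ → Outcome τ
    performs : (ν : Label) → (Branch ν → Com [] τ) → Outcome τ

  letOutcome : ∀ {τ τ′} → Outcome τ → Com (τ ∷ []) τ′ → Outcome τ′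
  letOutcome (returns V)    L = reduces (L [ V ])
  letOutcome (reduces M)    L = reduces (letin M L)
  letOutcome (performs ν k) L = performs ν (λ b → letin (k b) L)

  step : ∀ {τ} → Com [] τ → Outcome τ
  step (ƛ M · V)         = reduces (M [ V ])
  step (return V)        = returns V
  step (letin M L)       = letOutcome (step M) L
  step (fix F)           = reduces (return (unfold F))
  step (case Z M L)      = reduces M
  step (case (S V) M L)  = reduces (L [ V ])
  step (opFin σ Ms)      = performs (fin σ) (lookup Ms)
  step (opNFin σ V Ms)   = performs (Nfin σ (toℕ V)) (lookup Ms)
  step (opNat σ V)       = performs (nat σ) (λ n → V · numeral n)
  step (opNNat σ V W)    = performs (Nnat σ (toℕ V)) (λ n → W · numeral n)

  mutual
    approx : ∀ {τ} → Com [] τ → ℕ → Tree (Val [] τ)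
    approx M zero    = ⊥ᵀ
    approx M (suc n) = approxOutcome (step M) n

    approxOutcome : ∀ {τ} → Outcome τ → ℕ → Tree (Val [] τ)
    approxOutcome (returns V)    n = leafᵀ V
    approxOutcome (reduces M)    n = approx M n
    approxOutcome (performs ν k) n = nodeᵀ ν (λ b → approx (k b) n)

  mutual
    approx-chain : ∀ {τ} (M : Com [] τ) → IsChain (approx M)
    approx-chain M zero    p = bot≤
    approx-chain M (suc n) p = approxOutcome-chain (step M) n p

    approxOutcome-chain : ∀ {τ} (o : Outcome τ) → IsChain (approxOutcome o)
    approxOutcome-chain (returns V)    n p = refl
    approxOutcome-chain (reduces M)    n p = approx-chain M n p
    approxOutcome-chain (performs ν k) n p = nodeᵀ-mono ν (λ b → approx-chain (k b) n) p

  ∣_∣ : ∀ {τ} → Com [] τ → Tree (Val [] τ)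
  ∣ M ∣ = ⨆ (approx M) (approx-chain M)

data Fragment : Set where
  full positive : Fragment

module Behaviour (em : Classical) (Op : Signature) (𝒪 : Trees.Modalities Op) where

  open Language Op public
  open Trees Op public
  open Semantics em Op public
  open Modalities 𝒪 public

  infix 4 _⊨_ _⊑[_]_ _≡[_]_ _⊴_ _≼_

  -- o ⟪ A ⟫ is the set o(A) of trees.
  _⟪_⟫ : O → Pred X ℓ → Pred (Tree X) 0ℓ
  o ⟪ A ⟫ = λ t → t [∈ A ] ∈ ⟦ o ⟧

  -- Arbitrary conjunctions and disjunctions are over index types in Set, where
  -- terms, trees and sets of them (as predicates into Set) also live.
  data Formula : Fragment → Aspect → Ty → Set₁ where
    ⟨_⟩   : ∀ {𝓛} → ℕ → Formula 𝓛 val N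
    _↦_   : ∀ {𝓛 τ τ′} → Val [] τ → Formula 𝓛 com τ′ → Formula 𝓛 val (τ ⇒ τ′)
    modal : ∀ {𝓛 τ} → O → Formula 𝓛 val τ → Formula 𝓛 com τ
    ⋀ ⋁   : ∀ {𝓛 a τ} {I : Set} → (I → Formula 𝓛 a τ) → Formula 𝓛 a τ
    neg   : ∀ {a τ} → Formula full a τ → Formula full a τ

  _⊨_ : ∀ {𝓛 a τ} → Term a [] τ → Formula 𝓛 a τ → Set
  W ⊨ ⟨ n ⟩             = W ≡ numeral n
  W ⊨ (V ↦ Φ)           = W · V ⊨ Φ
  M ⊨ modal o φ         = ∣ M ∣ ∈ o ⟪ (λ V → V ⊨ φ) ⟫
  M ⊨ ⋀ φ               = ∀ i → M ⊨ φ i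
  M ⊨ ⋁ φ               = ∃[ i ] M ⊨ φ i
  M ⊨ neg φ             = ¬ M ⊨ φ

  _⊑[_]_ _≡[_]_ : ∀ {a τ} → Term a [] τ → Fragment → Term a [] τ → Set₁
  M ⊑[ 𝓛 ] M′ = (φ : Formula 𝓛 _ _) → M ⊨ φ → M′ ⊨ φ
  M ≡[ 𝓛 ] M′ = M ⊑[ 𝓛 ] M′ × M′ ⊑[ 𝓛 ] M

  BehaviouralPreorder BehaviouralEquivalence : Fragment → ClosedRel (lsuc 0ℓ)
  BehaviouralPreorder    𝓛 M M′ = M ⊑[ 𝓛 ] M′
  BehaviouralEquivalence 𝓛 M M′ = M ≡[ 𝓛 ] M′

  data Test : Set₁ where
    o⊤ o⊥ : O → Test
    ⋀ ⋁   : {I : Set} → (I → Test) → Test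

  ⟦_⟧ᵀ : Test → Pred (Tree ⊤) 0ℓ
  ⟦ o⊤ o ⟧ᵀ = o ⟪ U ⟫
  ⟦ o⊥ o ⟧ᵀ = o ⟪ ∅ ⟫
  ⟦ ⋀ Φ ⟧ᵀ  = λ t → ∀ i → t ∈ ⟦ Φ i ⟧ᵀ
  ⟦ ⋁ Φ ⟧ᵀ  = λ t → ∃[ i ] t ∈ ⟦ Φ i ⟧ᵀ

  _⊴_ : Rel (Tree ⊤) (lsuc 0ℓ)
  t ⊴ t′ = ∀ Φ → t ∈ ⟦ Φ ⟧ᵀ → t′ ∈ ⟦ Φ ⟧ᵀ

  _≼_ : Rel (Tree (Tree ⊤)) (lsuc 0ℓ)
  r ≼ r′ = ∀ o Φ → r ∈ o ⟪ ⟦ Φ ⟧ᵀ ⟫ → r′ ∈ o ⟪ ⟦ Φ ⟧ᵀ ⟫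

  Decomposable : Set₁
  Decomposable = ∀ r r′ → r ≼ r′ → μ r ⊴ μ r′

  AllScottOpen : Set
  AllScottOpen = ∀ o → ScottOpen ⟦ o ⟧

{-# OPTIONS --safe #-}

-- A relation R between leaves lifts to trees: t is related to u when, for all o
-- and A, t ∈ o(A) implies u ∈ o(R ↑ A), where R ↑ A is the image of A under R.
-- Replacing inner trees t by t[∈ A] and u by u[∈ R ↑ A] reduces arbitrary trees
-- of trees to the trees of trees over 𝟏 of which decomposability speaks, so the
-- lifting is preserved by bind, hence by sequencing and by effect nodes;
-- Scott-openness makes it pass to suprema on the left.
-- Each behavioural preorder is an applicative simulation for this lifting,
-- since the up-set of a value is defined by a formula of the fragment.  Howe's
-- closure of it is a substitutive congruence, and a simulation by induction on
-- the approximations of effect trees; so is its transitive closure, which is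
-- moreover symmetric if the preorder is.  Formulas are preserved by simulations
-- (by symmetric ones in the presence of negation), so Howe's closure is
-- contained in the preorder and its open extension is compatible.
module Submission where

open import Defs
open import Data.Empty using (⊥)
open import Data.List using ([]; _∷_)
open import Data.Nat using (ℕ; zero; suc)
import Data.Nat as ℕ
import Data.Nat.Properties as ℕ
open import Data.Product using (∃-syntax; _×_; _,_; proj₁; proj₂)
open import Data.Unit using (⊤)
open import Data.Vec using (Vec; []; _∷_)
open import Data.Vec.Relation.Binary.Pointwise.Inductive as Pointwise using (Pointwise; []; _∷_)
open import Level using (Level; 0ℓ; Lift; lift; lower) renaming (suc to lsuc)
open import Relation.Binary using (REL; Rel)
open import Relation.Binary.Construct.Closure.ReflexiveTransitive
  using (Star; ε; _◅_; _◅◅_; gmap; fold)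
open import Relation.Binary.PropositionalEquality
  using (_≡_; refl; sym; trans; cong; cong₂; subst; subst₂; module ≡-Reasoning)
open import Relation.Nullary using (¬_; yes; no; contradiction)
open import Relation.Nullary.Decidable using (True; toWitness; fromWitness; decidable-stable)
open import Relation.Unary using (Pred; _∈_; ∅; U)

private
  cong₃ : ∀ {a b c d} {A : Set a} {B : Set b} {C : Set c} {D : Set d}
          (f : A → B → C → D) {x x′ y y′ w w′} →
          x ≡ x′ → y ≡ y′ → w ≡ w′ → f x y w ≡ f x′ y′ w′
  cong₃ f refl refl refl = refl

-- Laws of renaming and substitution.

module Substitution (Op : Signature) where

  open Language Op

  infix 4 _≗_
  -- Substitutions are functions, so they are compared pointwise. The laws below take such an
  -- equation as a parameter, which lets the induction pass under binders without function
  -- extensionality.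
  _≗_ : ∀ {Γ Δ} → Sub Γ Δ → Sub Γ Δ → Set
  θ ≗ η = ∀ {τ} (x : _ ∋ τ) → θ x ≡ η x

  liftSub-var : ∀ {Γ τ} {θ : Sub Γ Γ} → θ ≗ var → liftSub {τ = τ} θ ≗ var
  liftSub-var e z     = refl
  liftSub-var e (s x) = cong weaken (e x)

  mutual
    sub-id : ∀ {a Γ τ} {θ : Sub Γ Γ} → θ ≗ var → (M : Term a Γ τ) → sub θ M ≡ M
    sub-id e ⋆               = refl
    sub-id e Z               = refl
    sub-id e (S V)           = cong S (sub-id e V)
    sub-id e (ƛ M)           = cong ƛ (sub-id (liftSub-var e) M)
    sub-id e (var x)         = e x
    sub-id e (V · W)         = cong₂ _·_ (sub-id e V) (sub-id e W)
    sub-id e (return V)      = cong return (sub-id e V)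
    sub-id e (letin M L)     = cong₂ letin (sub-id e M) (sub-id (liftSub-var e) L)
    sub-id e (fix V)         = cong fix (sub-id e V)
    sub-id e (case V M L)    = cong₃ case (sub-id e V) (sub-id e M) (sub-id (liftSub-var e) L)
    sub-id e (opFin σ Ms)    = cong (opFin σ) (subs-id e Ms)
    sub-id e (opNFin σ V Ms) = cong₂ (opNFin σ) (sub-id e V) (subs-id e Ms)
    sub-id e (opNat σ V)     = cong (opNat σ) (sub-id e V)
    sub-id e (opNNat σ V W)  = cong₂ (opNNat σ) (sub-id e V) (sub-id e W)

    subs-id : ∀ {a Γ τ n} {θ : Sub Γ Γ} → θ ≗ var → (Ms : Vec (Term a Γ τ) n) → subs θ Ms ≡ Ms
    subs-id e []       = refl
    subs-id e (M ∷ Ms) = cong₂ _∷_ (sub-id e M) (subs-id e Ms)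

  liftSub-ren : ∀ {Γ Δ τ} {ρ : Ren Γ Δ} {θ : Sub Γ Δ} → (λ x → var (ρ x)) ≗ θ →
                (λ x → var (liftRen {τ = τ} ρ x)) ≗ liftSub θ
  liftSub-ren e z     = refl
  liftSub-ren e (s x) = cong weaken (e x)

  mutual
    rename-as-sub : ∀ {a Γ Δ τ} {ρ : Ren Γ Δ} {θ : Sub Γ Δ} → (λ x → var (ρ x)) ≗ θ →
                    (M : Term a Γ τ) → rename ρ M ≡ sub θ M
    rename-as-sub e ⋆               = refl
    rename-as-sub e Z               = refl
    rename-as-sub e (S V)           = cong S (rename-as-sub e V)
    rename-as-sub e (ƛ M)           = cong ƛ (rename-as-sub (liftSub-ren e) M)
    rename-as-sub e (var x)         = e x
    rename-as-sub e (V · W)         = cong₂ _·_ (rename-as-sub e V) (rename-as-sub e W)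
    rename-as-sub e (return V)      = cong return (rename-as-sub e V)
    rename-as-sub e (letin M L)     = cong₂ letin (rename-as-sub e M) (rename-as-sub (liftSub-ren e) L)
    rename-as-sub e (fix V)         = cong fix (rename-as-sub e V)
    rename-as-sub e (case V M L)    =
      cong₃ case (rename-as-sub e V) (rename-as-sub e M) (rename-as-sub (liftSub-ren e) L)
    rename-as-sub e (opFin σ Ms)    = cong (opFin σ) (renames-as-subs e Ms)
    rename-as-sub e (opNFin σ V Ms) = cong₂ (opNFin σ) (rename-as-sub e V) (renames-as-subs e Ms)
    rename-as-sub e (opNat σ V)     = cong (opNat σ) (rename-as-sub e V)
    rename-as-sub e (opNNat σ V W)  = cong₂ (opNNat σ) (rename-as-sub e V) (rename-as-sub e W)

    renames-as-subs : ∀ {a Γ Δ τ n} {ρ : Ren Γ Δ} {θ : Sub Γ Δ} → (λ x → var (ρ x)) ≗ θ →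
                      (Ms : Vec (Term a Γ τ) n) → renames ρ Ms ≡ subs θ Ms
    renames-as-subs e []       = refl
    renames-as-subs e (M ∷ Ms) = cong₂ _∷_ (rename-as-sub e M) (renames-as-subs e Ms)

  liftSub-liftRen : ∀ {Γ Δ Ξ τ} {ρ : Ren Γ Δ} {θ : Sub Δ Ξ} {η : Sub Γ Ξ} → (λ x → θ (ρ x)) ≗ η →
                    (λ x → liftSub {τ = τ} θ (liftRen ρ x)) ≗ liftSub η
  liftSub-liftRen e z     = refl
  liftSub-liftRen e (s x) = cong weaken (e x)

  mutual
    sub-rename : ∀ {a Γ Δ Ξ τ} {ρ : Ren Γ Δ} {θ : Sub Δ Ξ} {η : Sub Γ Ξ} → (λ x → θ (ρ x)) ≗ η →
                 (M : Term a Γ τ) → sub θ (rename ρ M) ≡ sub η M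
    sub-rename e ⋆               = refl
    sub-rename e Z               = refl
    sub-rename e (S V)           = cong S (sub-rename e V)
    sub-rename e (ƛ M)           = cong ƛ (sub-rename (liftSub-liftRen e) M)
    sub-rename e (var x)         = e x
    sub-rename e (V · W)         = cong₂ _·_ (sub-rename e V) (sub-rename e W)
    sub-rename e (return V)      = cong return (sub-rename e V)
    sub-rename e (letin M L)     = cong₂ letin (sub-rename e M) (sub-rename (liftSub-liftRen e) L)
    sub-rename e (fix V)         = cong fix (sub-rename e V)
    sub-rename e (case V M L)    =
      cong₃ case (sub-rename e V) (sub-rename e M) (sub-rename (liftSub-liftRen e) L)
    sub-rename e (opFin σ Ms)    = cong (opFin σ) (subs-renames e Ms)
    sub-rename e (opNFin σ V Ms) = cong₂ (opNFin σ) (sub-rename e V) (subs-renames e Ms)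
    sub-rename e (opNat σ V)     = cong (opNat σ) (sub-rename e V)
    sub-rename e (opNNat σ V W)  = cong₂ (opNNat σ) (sub-rename e V) (sub-rename e W)

    subs-renames : ∀ {a Γ Δ Ξ τ n} {ρ : Ren Γ Δ} {θ : Sub Δ Ξ} {η : Sub Γ Ξ} →
                   (λ x → θ (ρ x)) ≗ η →
                   (Ms : Vec (Term a Γ τ) n) → subs θ (renames ρ Ms) ≡ subs η Ms
    subs-renames e []       = refl
    subs-renames e (M ∷ Ms) = cong₂ _∷_ (sub-rename e M) (subs-renames e Ms)

  -- Once the outer renamings are read as substitutions, `sub-rename` fuses each side into the same
  -- substitution instance of `M`.
  weaken-rename : ∀ {a Γ Δ τ τ′} (ρ : Ren Γ Δ) (M : Term a Γ τ) →
                  rename (liftRen {τ = τ′} ρ) (weaken M) ≡ weaken (rename ρ M)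
  weaken-rename ρ M = begin
    rename (liftRen ρ) (weaken M)             ≡⟨ rename-as-sub (λ _ → refl) (weaken M) ⟩
    sub (λ x → var (liftRen ρ x)) (weaken M)  ≡⟨ sub-rename (λ _ → refl) M ⟩
    sub (λ x → var (s (ρ x))) M               ≡⟨ sub-rename (λ _ → refl) M ⟨
    sub (λ x → var (s x)) (rename ρ M)        ≡⟨ rename-as-sub (λ _ → refl) (rename ρ M) ⟨
    weaken (rename ρ M)                       ∎
    where open ≡-Reasoning

  liftRen-liftSub : ∀ {Γ Δ Ξ τ} {θ : Sub Γ Δ} {ρ : Ren Δ Ξ} {η : Sub Γ Ξ} →
                    (λ x → rename ρ (θ x)) ≗ η →
                    (λ x → rename (liftRen {τ = τ} ρ) (liftSub θ x)) ≗ liftSub η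
  liftRen-liftSub                   e z     = refl
  liftRen-liftSub {θ = θ} {ρ = ρ} e (s x) = trans (weaken-rename ρ (θ x)) (cong weaken (e x))

  mutual
    rename-sub : ∀ {a Γ Δ Ξ τ} {θ : Sub Γ Δ} {ρ : Ren Δ Ξ} {η : Sub Γ Ξ} →
                 (λ x → rename ρ (θ x)) ≗ η →
                 (M : Term a Γ τ) → rename ρ (sub θ M) ≡ sub η M
    rename-sub e ⋆               = refl
    rename-sub e Z               = refl
    rename-sub e (S V)           = cong S (rename-sub e V)
    rename-sub e (ƛ M)           = cong ƛ (rename-sub (liftRen-liftSub e) M)
    rename-sub e (var x)         = e x
    rename-sub e (V · W)         = cong₂ _·_ (rename-sub e V) (rename-sub e W)
    rename-sub e (return V)      = cong return (rename-sub e V)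
    rename-sub e (letin M L)     = cong₂ letin (rename-sub e M) (rename-sub (liftRen-liftSub e) L)
    rename-sub e (fix V)         = cong fix (rename-sub e V)
    rename-sub e (case V M L)    =
      cong₃ case (rename-sub e V) (rename-sub e M) (rename-sub (liftRen-liftSub e) L)
    rename-sub e (opFin σ Ms)    = cong (opFin σ) (renames-subs e Ms)
    rename-sub e (opNFin σ V Ms) = cong₂ (opNFin σ) (rename-sub e V) (renames-subs e Ms)
    rename-sub e (opNat σ V)     = cong (opNat σ) (rename-sub e V)
    rename-sub e (opNNat σ V W)  = cong₂ (opNNat σ) (rename-sub e V) (rename-sub e W)

    renames-subs : ∀ {a Γ Δ Ξ τ n} {θ : Sub Γ Δ} {ρ : Ren Δ Ξ} {η : Sub Γ Ξ} →
                   (λ x → rename ρ (θ x)) ≗ η →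
                   (Ms : Vec (Term a Γ τ) n) → renames ρ (subs θ Ms) ≡ subs η Ms
    renames-subs e []       = refl
    renames-subs e (M ∷ Ms) = cong₂ _∷_ (rename-sub e M) (renames-subs e Ms)

  liftSub-liftSub : ∀ {Γ Δ Ξ τ} {θ : Sub Γ Δ} {η : Sub Δ Ξ} {ζ : Sub Γ Ξ} →
                    (λ x → sub η (θ x)) ≗ ζ →
                    (λ x → sub (liftSub {τ = τ} η) (liftSub θ x)) ≗ liftSub ζ
  liftSub-liftSub                         e z     = refl
  liftSub-liftSub {θ = θ} {η = η} {ζ = ζ} e (s x) = begin
    sub (liftSub η) (weaken (θ x))  ≡⟨ sub-rename (λ _ → refl) (θ x) ⟩
    sub (λ y → weaken (η y)) (θ x)  ≡⟨ rename-sub (λ _ → refl) (θ x) ⟨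
    weaken (sub η (θ x))            ≡⟨ cong weaken (e x) ⟩
    weaken (ζ x)                    ∎
    where open ≡-Reasoning

  mutual
    sub-sub : ∀ {a Γ Δ Ξ τ} {θ : Sub Γ Δ} {η : Sub Δ Ξ} {ζ : Sub Γ Ξ} →
              (λ x → sub η (θ x)) ≗ ζ →
              (M : Term a Γ τ) → sub η (sub θ M) ≡ sub ζ M
    sub-sub e ⋆               = refl
    sub-sub e Z               = refl
    sub-sub e (S V)           = cong S (sub-sub e V)
    sub-sub e (ƛ M)           = cong ƛ (sub-sub (liftSub-liftSub e) M)
    sub-sub e (var x)         = e x
    sub-sub e (V · W)         = cong₂ _·_ (sub-sub e V) (sub-sub e W)
    sub-sub e (return V)      = cong return (sub-sub e V)
    sub-sub e (letin M L)     = cong₂ letin (sub-sub e M) (sub-sub (liftSub-liftSub e) L)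
    sub-sub e (fix V)         = cong fix (sub-sub e V)
    sub-sub e (case V M L)    =
      cong₃ case (sub-sub e V) (sub-sub e M) (sub-sub (liftSub-liftSub e) L)
    sub-sub e (opFin σ Ms)    = cong (opFin σ) (subs-subs e Ms)
    sub-sub e (opNFin σ V Ms) = cong₂ (opNFin σ) (sub-sub e V) (subs-subs e Ms)
    sub-sub e (opNat σ V)     = cong (opNat σ) (sub-sub e V)
    sub-sub e (opNNat σ V W)  = cong₂ (opNNat σ) (sub-sub e V) (sub-sub e W)

    subs-subs : ∀ {a Γ Δ Ξ τ n} {θ : Sub Γ Δ} {η : Sub Δ Ξ} {ζ : Sub Γ Ξ} →
                (λ x → sub η (θ x)) ≗ ζ →
                (Ms : Vec (Term a Γ τ) n) → subs η (subs θ Ms) ≡ subs ζ Ms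
    subs-subs e []       = refl
    subs-subs e (M ∷ Ms) = cong₂ _∷_ (sub-sub e M) (subs-subs e Ms)

-- Compatible refinement and chains.

module Congruence (Op : Signature) where

  open Language Op

  private
    variable
      ℓ ℓ′ : Level
      a : Aspect
      Γ : Ctx
      τ τ′ : Ty

  -- This is the compatible refinement of `R`: `R` is compatible exactly when it contains `Cong R`.
  -- Having it as a datatype makes derivations available for induction.
  data Cong (R : OpenRel ℓ) : ∀ {a Γ τ} → Rel (Term a Γ τ) ℓ where
    ⋆       : Cong R {Γ = Γ} ⋆ ⋆
    Z       : Cong R {Γ = Γ} Z Z
    S       : {V V′ : Val Γ N} → R V V′ → Cong R (S V) (S V′)
    ƛ       : {M M′ : Com (τ ∷ Γ) τ′} → R M M′ → Cong R (ƛ M) (ƛ M′)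
    var     : (x : Γ ∋ τ) → Cong R (var x) (var x)
    _·_     : {V V′ : Val Γ (τ ⇒ τ′)} {W W′ : Val Γ τ} →
              R V V′ → R W W′ → Cong R (V · W) (V′ · W′)
    return  : {V V′ : Val Γ τ} → R V V′ → Cong R (return V) (return V′)
    letin   : {M M′ : Com Γ τ} {L L′ : Com (τ ∷ Γ) τ′} →
              R M M′ → R L L′ → Cong R (letin M L) (letin M′ L′)
    fix     : {V V′ : Val Γ ((τ ⇒ τ′) ⇒ (τ ⇒ τ′))} → R V V′ → Cong R (fix V) (fix V′)
    case    : {V V′ : Val Γ N} {M M′ : Com Γ τ} {L L′ : Com (N ∷ Γ) τ} →
              R V V′ → R M M′ → R L L′ → Cong R (case V M L) (case V′ M′ L′)
    opFin   : ∀ {n} (σ : Op α^ n ⇒α) {Ms Ms′ : Vec (Com Γ τ) n} →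
              Pointwise R Ms Ms′ → Cong R (opFin σ Ms) (opFin σ Ms′)
    opNFin  : ∀ {n} (σ : Op N×α^ n ⇒α) {V V′ : Val Γ N} {Ms Ms′ : Vec (Com Γ τ) n} →
              R V V′ → Pointwise R Ms Ms′ → Cong R (opNFin σ V Ms) (opNFin σ V′ Ms′)
    opNat   : (σ : Op α^N⇒α) {V V′ : Val Γ (N ⇒ τ)} →
              R V V′ → Cong R (opNat σ V) (opNat σ V′)
    opNNat  : (σ : Op N×α^N⇒α) {V V′ : Val Γ N} {W W′ : Val Γ (N ⇒ τ)} →
              R V V′ → R W W′ → Cong R (opNNat σ V W) (opNNat σ V′ W′)

  Cong-map : {R : OpenRel ℓ} {R′ : OpenRel ℓ′} →
             (∀ {a Γ τ} {M M′ : Term a Γ τ} → R M M′ → R′ M M′) →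
             {M M′ : Term a Γ τ} → Cong R M M′ → Cong R′ M M′
  Cong-map f ⋆               = ⋆
  Cong-map f Z               = Z
  Cong-map f (S r)           = S (f r)
  Cong-map f (ƛ r)           = ƛ (f r)
  Cong-map f (var x)         = var x
  Cong-map f (r · q)         = f r · f q
  Cong-map f (return r)      = return (f r)
  Cong-map f (letin r q)     = letin (f r) (f q)
  Cong-map f (fix r)         = fix (f r)
  Cong-map f (case r q p)    = case (f r) (f q) (f p)
  Cong-map f (opFin σ rs)    = opFin σ (Pointwise.map f rs)
  Cong-map f (opNFin σ r rs) = opNFin σ (f r) (Pointwise.map f rs)
  Cong-map f (opNat σ r)     = opNat σ (f r)
  Cong-map f (opNNat σ r q)  = opNNat σ (f r) (f q)

  Cong-sym : {R R′ : OpenRel ℓ} →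
             (∀ {a Γ τ} {M M′ : Term a Γ τ} → R M M′ → R′ M′ M) →
             {M M′ : Term a Γ τ} → Cong R M M′ → Cong R′ M′ M
  Cong-sym f ⋆               = ⋆
  Cong-sym f Z               = Z
  Cong-sym f (S r)           = S (f r)
  Cong-sym f (ƛ r)           = ƛ (f r)
  Cong-sym f (var x)         = var x
  Cong-sym f (r · q)         = f r · f q
  Cong-sym f (return r)      = return (f r)
  Cong-sym f (letin r q)     = letin (f r) (f q)
  Cong-sym f (fix r)         = fix (f r)
  Cong-sym f (case r q p)    = case (f r) (f q) (f p)
  Cong-sym f (opFin σ rs)    = opFin σ (Pointwise.sym f rs)
  Cong-sym f (opNFin σ r rs) = opNFin σ (f r) (Pointwise.sym f rs)
  Cong-sym f (opNat σ r)     = opNat σ (f r)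
  Cong-sym f (opNNat σ r q)  = opNNat σ (f r) (f q)

  compatible : {R : OpenRel ℓ} →
               (∀ {a Γ τ} {M M′ : Term a Γ τ} → Cong R M M′ → R M M′) → Compatible R
  compatible f = record
    { ⋆-compat      = f ⋆
    ; Z-compat      = f Z
    ; S-compat      = λ r → f (S r)
    ; ƛ-compat      = λ r → f (ƛ r)
    ; var-compat    = λ x → f (var x)
    ; ·-compat      = λ r q → f (r · q)
    ; return-compat = λ r → f (return r)
    ; let-compat    = λ r q → f (letin r q)
    ; fix-compat    = λ r → f (fix r)
    ; case-compat   = λ r q p → f (case r q p)
    ; opFin-compat  = λ σ rs → f (opFin σ rs)
    ; opNFin-compat = λ σ r rs → f (opNFin σ r rs)
    ; opNat-compat  = λ σ r → f (opNat σ r)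
    ; opNNat-compat = λ σ r q → f (opNNat σ r q)
    }

  module _ {R : OpenRel ℓ}
    (reflexive : ∀ {a Γ τ} {M : Term a Γ τ} → R M M)
    (congruent : ∀ {a Γ τ} {M M′ : Term a Γ τ} → Cong R M M′ → R M M′) where

    private
      R⋆ : OpenRel ℓ
      R⋆ = Star R

      reflexives : ∀ {n} {Ms : Vec (Term a Γ τ) n} → Pointwise R Ms Ms
      reflexives = Pointwise.refl reflexive

      pointwise⋆ : ∀ {n} {Ms Ms′ : Vec (Term a Γ τ) n} →
                   Pointwise R⋆ Ms Ms′ → Star (Pointwise R) Ms Ms′
      pointwise⋆ []       = ε
      pointwise⋆ {Ms′ = M′ ∷ _} (r ∷ rs) =
        gmap (_∷ _) (_∷ reflexives) r ◅◅ gmap (M′ ∷_) (reflexive ∷_) (pointwise⋆ rs)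

      gmap-cong : ∀ {A : Set} {Q : Rel A ℓ} {f : A → Term a Γ τ} →
                  (∀ {x y} → Q x y → Cong R (f x) (f y)) → ∀ {x y} → Star Q x y → R⋆ (f x) (f y)
      gmap-cong h = gmap _ (λ q → congruent (h q))

    -- The immediate subterms move along their chains one after another; reflexivity of `R` holds
    -- the remaining ones fixed meanwhile.
    Star-congruent : {M M′ : Term a Γ τ} → Cong R⋆ M M′ → R⋆ M M′
    Star-congruent ⋆               = ε
    Star-congruent Z               = ε
    Star-congruent (S r)           = gmap-cong S r
    Star-congruent (ƛ r)           = gmap-cong ƛ r
    Star-congruent (var x)         = ε
    Star-congruent (r · q)         = gmap-cong (_· reflexive) r ◅◅ gmap-cong (reflexive ·_) q
    Star-congruent (return r)      = gmap-cong return r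
    Star-congruent (letin r q)     =
      gmap-cong (λ h → letin h reflexive) r ◅◅ gmap-cong (letin reflexive) q
    Star-congruent (fix r)         = gmap-cong fix r
    Star-congruent (case r q p)    =
      gmap-cong (λ h → case h reflexive reflexive) r ◅◅
      gmap-cong (λ h → case reflexive h reflexive) q ◅◅
      gmap-cong (case reflexive reflexive) p
    Star-congruent (opFin σ rs)    = gmap-cong (opFin σ) (pointwise⋆ rs)
    Star-congruent (opNFin σ r rs) =
      gmap-cong (λ h → opNFin σ h reflexives) r ◅◅ gmap-cong (opNFin σ reflexive) (pointwise⋆ rs)
    Star-congruent (opNat σ r)     = gmap-cong (opNat σ) r
    Star-congruent (opNNat σ r q)  =
      gmap-cong (λ h → opNNat σ h reflexive) r ◅◅ gmap-cong (opNNat σ reflexive) q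

-- Restriction, bind and suprema of trees.

module TreeProperties (em : Classical) (Op : Signature) where

  open Trees Op
  open Semantics em Op
  open Language Op

  private
    variable
      ℓ ℓ′ : Level
      X Y : Set
      P : Pred X ℓ
      Q : Pred X ℓ′

  ≡⇒≤ˢ : {x y : Shape X} → x ≡ y → x ≤ˢ y
  ≡⇒≤ˢ refl = refl

  mapShape : (X → Y) → Shape X → Shape Y
  mapShape f bot      = bot
  mapShape f (leaf x) = leaf (f x)
  mapShape f (node ν) = node ν

  mapᵀ : (X → Y) → Tree X → Tree Y
  mapᵀ f t .at p               = mapShape f (at t p)
  mapᵀ f t .coherent p ν b q d =
    cong (mapShape f) (coherent t p ν b q (λ e → d (cong (mapShape f) e)))

  bindᵀ : Tree X → (X → Tree Y) → Tree Y
  bindᵀ t f = μ (mapᵀ f t)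

  restrict-mono : (∀ {x} → P x → Q x) → {x y : Shape X} → x ≤ˢ y → restrict P x ≤ˢ restrict Q y
  restrict-mono         P⊆Q bot≤            = bot≤
  restrict-mono         P⊆Q {bot} refl      = refl
  restrict-mono {P = P} {Q = Q} P⊆Q {leaf x} refl with em {P = P x} | em {P = Q x}
  ... | yes _ | yes _  = refl
  ... | yes p | no ¬q  = contradiction (P⊆Q p) ¬q
  ... | no _  | _      = bot≤
  restrict-mono         P⊆Q {node ν} refl   = refl

  [∈]-mono : (∀ {x} → P x → Q x) → (t u : Tree X) → t ≤ u → t [∈ P ] ≤ u [∈ Q ]
  [∈]-mono P⊆Q t u t≤u p = restrict-mono P⊆Q (t≤u p)

  [∈U]-≈ : (t : Tree ⊤) → t [∈ U ] ≈ t
  [∈U]-≈ t p with at t p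
  ... | bot    = refl
  ... | leaf x with em {P = ⊤}
  ...   | yes _ = refl
  ...   | no ¬⊤ = contradiction x ¬⊤
  [∈U]-≈ t p | node ν = refl

  [∈]-[∈∅] : (t : Tree X) → (t [∈ P ]) [∈ ∅ ] ≈ t [∈ ∅ ]
  [∈]-[∈∅] {P = P} t p = lemma (at t p)
    where
    lemma : ∀ x → restrict ∅ (restrict P x) ≡ restrict ∅ x
    lemma bot      = refl
    lemma (leaf x) with em {P = P x}
    ... | no _  with em {P = ⊥}
    ...   | no _ = refl
    lemma (leaf x) | yes _ with em {P = ⊥}
    ...   | no _ = refl
    lemma (node ν) = refl

  [∈]-mapᵀ : (f : X → Y) {P : Pred Y ℓ} (t : Tree X) →
             mapᵀ f t [∈ P ] ≈ t [∈ (λ x → P (f x)) ]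
  [∈]-mapᵀ f {P} t p with at t p
  ... | bot    = refl
  ... | leaf x with em {P = P (f x)}
  ...   | yes _ = refl
  ...   | no _  = refl
  [∈]-mapᵀ f {P} t p | node ν = refl

  [∈]-bindᵀ : (f : X → Tree Y) {P : Pred Y ℓ} (t : Tree X) →
              bindᵀ t f [∈ P ] ≈ bindᵀ t (λ x → f x [∈ P ])
  [∈]-bindᵀ {X = X} f {P} t = go (at t)
    where
    -- Stated for bare shape functions because the recursion descends to the function shifted by
    -- `e`, which does not come packaged as a `Tree`.
    go : (t : Path → Shape X) → ∀ p →
         restrict P (flatten (λ q → mapShape f (t q)) p) ≡
         flatten (λ q → mapShape (λ x → f x [∈ P ]) (t q)) p
    go t [] with t []
    ... | bot    = refl
    ... | leaf x = refl
    ... | node ν = refl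
    go t (e ∷ p) with t []
    ... | bot    = refl
    ... | leaf x = refl
    ... | node ν = go (λ q → t (e ∷ q)) p

  bindᵀ-monoʳ : (t : Tree X) {f g : X → Tree Y} → (∀ x → f x ≤ g x) → bindᵀ t f ≤ bindᵀ t g
  bindᵀ-monoʳ {X = X} t {f} {g} f≤g = go (at t)
    where
    go : (t : Path → Shape X) → ∀ p →
         flatten (λ q → mapShape f (t q)) p ≤ˢ flatten (λ q → mapShape g (t q)) p
    go t [] with t []
    ... | bot    = refl
    ... | leaf x = f≤g x []
    ... | node ν = refl
    go t (e ∷ p) with t []
    ... | bot    = refl
    ... | leaf x = f≤g x (e ∷ p)
    ... | node ν = go (λ q → t (e ∷ q)) p

  bindᵀ-leafᵀ : (x : X) (f : X → Tree Y) → bindᵀ (leafᵀ x) f ≈ f x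
  bindᵀ-leafᵀ x f []      = refl
  bindᵀ-leafᵀ x f (_ ∷ _) = refl

  bindᵀ-nodeᵀ : ∀ ν (k : Branch ν → Tree X) (f : X → Tree Y) →
                bindᵀ (nodeᵀ ν k) f ≈ nodeᵀ ν (λ b → bindᵀ (k b) f)
  bindᵀ-nodeᵀ ν k f []             = refl
  bindᵀ-nodeᵀ ν k f ((ν′ , b) ∷ p) with em {P = ν′ ≡ ν}
  ... | yes refl = refl
  ... | no _     = flatten-bot _ p refl

  -- Presents an effect node as a bind over the tree of its own branch indices, so that whatever
  -- bind preserves is preserved by nodes.
  bindᵀ-nodeᵀ-leafᵀ : ∀ ν (f : Branch ν → Tree Y) → bindᵀ (nodeᵀ ν leafᵀ) f ≈ nodeᵀ ν f
  bindᵀ-nodeᵀ-leafᵀ ν f []             = refl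
  bindᵀ-nodeᵀ-leafᵀ ν f ((ν′ , b) ∷ p) with em {P = ν′ ≡ ν}
  ... | yes refl = bindᵀ-leafᵀ b f p
  ... | no _     = flatten-bot _ p refl

  -- The value of `flatten f` at p depends on f only at the finitely many
  -- prefixes of p.
  flatten-eventually :
    (c : ℕ → Path → Shape (Tree X)) (f : Path → Shape (Tree X)) →
    (∀ p → ∃[ n ] ∀ m → n ℕ.≤ m → c m p ≡ f p) →
    ∀ p → ∃[ n ] ∀ m → n ℕ.≤ m → flatten (c m) p ≡ flatten f p
  flatten-eventually c f h [] with h []
  ... | n , e = n , λ m n≤m → lemma m (e m n≤m)
    where
    lemma : ∀ m → c m [] ≡ f [] → flatten (c m) [] ≡ flatten f []
    lemma m eq rewrite eq = refl
  flatten-eventually c f h (b ∷ p)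
    with h [] | flatten-eventually (λ n q → c n (b ∷ q)) (λ q → f (b ∷ q)) (λ q → h (b ∷ q)) p
  ... | n , e | n′ , e′ = n ℕ.⊔ n′ , λ m l →
      lemma m (e m (ℕ.m⊔n≤o⇒m≤o n n′ l)) (e′ m (ℕ.m⊔n≤o⇒n≤o n n′ l))
    where
    lemma : ∀ m → c m [] ≡ f [] →
            flatten (λ q → c m (b ∷ q)) p ≡ flatten (λ q → f (b ∷ q)) p →
            flatten (c m) (b ∷ p) ≡ flatten f (b ∷ p)
    lemma m eq eq′ rewrite eq with f []
    ... | bot    = refl
    ... | leaf _ = refl
    ... | node _ = eq′

  ⨆At-least : (c : ℕ → Tree X) → ∀ p {x} → (∀ n → at (c n) p ≤ˢ x) → ⨆At c p ≤ˢ x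
  ⨆At-least c p h with em {P = ∃[ n ] ¬ at (c n) p ≡ bot}
  ... | yes (n , _) = h n
  ... | no _        = bot≤

  -- The order on shapes is flat, so along a chain the shape at a given path changes at most once,
  -- from `bot` to its final value.
  ⨆At-attained : (c : ℕ → Tree X) → IsChain c → ∀ p →
                 ∃[ n ] ∀ m → n ℕ.≤ m → at (c m) p ≡ ⨆At c p
  ⨆At-attained c mono p with em {P = ∃[ n ] ¬ at (c n) p ≡ bot}
  ... | yes (n , d) = n , λ m n≤m → ≤ˢ-defined (chain-≤ c mono (ℕ.≤⇒≤′ n≤m) p) d
  ... | no ∄        = 0 , λ m _ → decidable-stable em (λ d → ∄ (m , d))

  -- At a fixed path bind inspects only finitely many shapes of its first argument, so there a late
  -- enough `c n` can stand for the supremum.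
  bindᵀ-⨆ : (c : ℕ → Tree X) (mono : IsChain c) (f : X → Tree Y) (u : Tree Y) →
            (∀ n → bindᵀ (c n) f ≤ u) → bindᵀ (⨆ c mono) f ≤ u
  bindᵀ-⨆ c mono f u h p
    with flatten-eventually (λ n → at (mapᵀ f (c n))) (at (mapᵀ f (⨆ c mono)))
           (λ q → let n , e = ⨆At-attained c mono q in n , λ m l → cong (mapShape f) (e m l)) p
  ... | n , e = subst (_≤ˢ at u p) (e n ℕ.≤-refl) (h n p)

  -- Works for infinitely many branches because the comparison is made path by path, and a path
  -- enters a single branch.
  nodeᵀ-⨆ : ∀ ν (c : Branch ν → ℕ → Tree X) (mono : ∀ b → IsChain (c b)) (u : Tree X) →
            (∀ n → nodeᵀ ν (λ b → c b n) ≤ u) → nodeᵀ ν (λ b → ⨆ (c b) (mono b)) ≤ u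
  -- The root shape is `node ν` at every index; 0 is an arbitrary choice.
  nodeᵀ-⨆ ν c mono u h []             = h 0 []
  nodeᵀ-⨆ ν c mono u h ((ν′ , b) ∷ p) with em {P = ν′ ≡ ν} | (λ n → h n ((ν′ , b) ∷ p))
  ... | yes refl | h′ = ⨆At-least (c b) p h′
  ... | no _     | _  = bot≤

  -- Puts restricted chains in the form that Scott-openness expects. It holds since the shape of the
  -- supremum at a path is either `bot` or that of some `c n`.
  [∈]-isSup : (c : ℕ → Tree X) (mono : IsChain c) →
              IsSup (λ n → c n [∈ P ]) (⨆ c mono [∈ P ])
  [∈]-isSup {P = P} c mono =
    (λ n → [∈]-mono (λ p → p) (c n) (⨆ c mono) (⨆-isSup c mono .proj₁ n)) , least
    where
    least : ∀ u → (∀ n → c n [∈ P ] ≤ u) → ⨆ c mono [∈ P ] ≤ u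
    least u h p with em {P = ∃[ n ] ¬ at (c n) p ≡ bot}
    ... | yes (n , _) = h n p
    ... | no _        = bot≤

  -- Effect trees of programs and their approximations.

  approx≤∣∣ : ∀ {τ} (M : Com [] τ) n → approx M n ≤ ∣ M ∣
  approx≤∣∣ M = ⨆-isSup (approx M) (approx-chain M) .proj₁

  reduces-≤ : ∀ {τ} (M : Com [] τ) {M′} → step M ≡ reduces M′ → ∣ M′ ∣ ≤ ∣ M ∣
  reduces-≤ M {M′} eq = ⨆-isSup (approx M′) (approx-chain M′) .proj₂ ∣ M ∣ λ n →
    subst (λ o → approxOutcome o n ≤ ∣ M ∣) eq (approx≤∣∣ M (suc n))

  returns-≤ : ∀ {τ} (M : Com [] τ) {V} → step M ≡ returns V → leafᵀ V ≤ ∣ M ∣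
  returns-≤ M eq = subst (λ o → approxOutcome o 0 ≤ ∣ M ∣) eq (approx≤∣∣ M 1)

  performs-≤ : ∀ {τ} (M : Com [] τ) {ν k} → step M ≡ performs ν k →
               nodeᵀ ν (λ b → ∣ k b ∣) ≤ ∣ M ∣
  performs-≤ M {ν} {k} eq =
    nodeᵀ-⨆ ν (λ b → approx (k b)) (λ b → approx-chain (k b)) ∣ M ∣ λ n →
      subst (λ o → approxOutcome o n ≤ ∣ M ∣) eq (approx≤∣∣ M (suc n))

  -- The step that substitutes the returned value accounts for the fuel n
  -- in place of suc n in the continuation.
  approx-letin-≤ : ∀ {τ τ′} (M : Com [] τ) (L : Com (τ ∷ []) τ′) n →
                   approx (letin M L) (suc n) ≤
                   bindᵀ (approx M (suc n)) (λ V → approx (L [ V ]) n)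
  approx-letin-≤-suc : ∀ {τ τ′} (M : Com [] τ) (L : Com (τ ∷ []) τ′) n →
                       approx (letin M L) (suc n) ≤
                       bindᵀ (approx M (suc n)) (λ V → approx (L [ V ]) (suc n))

  approx-letin-≤ M L zero p with step M
  ... | returns V    = bot≤
  ... | reduces M′   = bot≤
  -- One unit of fuel yields a node whose children are all `⊥ᵀ`, which lies below every node with
  -- the same label.
  ... | performs ν k =
    ≤ˢ-trans (nodeᵀ-mono ν (λ _ _ → bot≤) p) (≡⇒≤ˢ (sym (bindᵀ-nodeᵀ ν _ _ p)))
  approx-letin-≤ M L (suc n) p with step M
  ... | returns V    = ≡⇒≤ˢ (sym (bindᵀ-leafᵀ V _ p))
  ... | reduces M′   = approx-letin-≤-suc M′ L n p
  ... | performs ν k = ≤ˢ-trans (nodeᵀ-mono ν (λ b → approx-letin-≤-suc (k b) L n) p)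
                         (≡⇒≤ˢ (sym (bindᵀ-nodeᵀ ν _ _ p)))

  approx-letin-≤-suc M L n p = ≤ˢ-trans (approx-letin-≤ M L n p)
    (bindᵀ-monoʳ (approx M (suc n)) (λ V → approx-chain (L [ V ]) n) p)

  -- By `bindᵀ-⨆` only the bound computation has to be approximated. The continuations keep their
  -- full trees, so induction on the fuel simply follows the steps of `M`.
  bindᵀ-≤-letin : ∀ {τ τ′} (M : Com [] τ) (L : Com (τ ∷ []) τ′) →
                  bindᵀ ∣ M ∣ (λ V → ∣ L [ V ] ∣) ≤ ∣ letin M L ∣
  bindᵀ-≤-letin M L = bindᵀ-⨆ (approx M) (approx-chain M) _ ∣ letin M L ∣ (go M)
    where
    go : ∀ M n → bindᵀ (approx M n) (λ V → ∣ L [ V ] ∣) ≤ ∣ letin M L ∣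
    go M zero    p = ≤ˢ-trans (≡⇒≤ˢ (flatten-bot _ p refl)) bot≤
    go M (suc n) p with step M in eq
    ... | returns V    = ≤ˢ-trans (≡⇒≤ˢ (bindᵀ-leafᵀ V _ p))
                           (reduces-≤ (letin M L) (cong (λ o → letOutcome o L) eq) p)
    ... | reduces M′   = ≤ˢ-trans (go M′ n p)
                           (reduces-≤ (letin M L) (cong (λ o → letOutcome o L) eq) p)
    ... | performs ν k =
      ≤ˢ-trans (≡⇒≤ˢ (bindᵀ-nodeᵀ ν _ _ p))
        (≤ˢ-trans (nodeᵀ-mono ν (λ b → go (k b) n) p)
          (performs-≤ (letin M L) (cong (λ o → letOutcome o L) eq) p))

-- Lifting relations from leaves to trees.

module HoweMethod (em : Classical) (Op : Signature) (𝒪 : Trees.Modalities Op)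
  (decomposable : Behaviour.Decomposable em Op 𝒪) (scottOpen : Behaviour.AllScottOpen em Op 𝒪) where

  open Behaviour em Op 𝒪
  open TreeProperties em Op
  open Substitution Op
  open Congruence Op

  private
    variable
      ℓ ℓ′ : Level
      X Y W : Set
      P : Pred X ℓ
      Q : Pred X ℓ′

  ℓ₁ : Level
  ℓ₁ = lsuc 0ℓ

  infix 25 _↑_
  _↑_ : REL X Y ℓ₁ → Pred X ℓ₁ → Pred Y ℓ₁
  (R ↑ A) y = ∃[ x ] A x × R x y

  -- A record rather than a function type, so that R, t and u can be inferred.
  record Related (R : REL X Y ℓ₁) (t : Tree X) (u : Tree Y) : Set (lsuc ℓ₁) where
    field
      transfer : ∀ o A → t ∈ o ⟪ A ⟫ → u ∈ o ⟪ R ↑ A ⟫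
  open Related public

  ⟪⟫-mono : ∀ o (t u : Tree X) → t ≤ u → (∀ {x} → P x → Q x) → t ∈ o ⟪ P ⟫ → u ∈ o ⟪ Q ⟫
  ⟪⟫-mono o t u t≤u P⊆Q = scottOpen o .proj₁ ([∈]-mono P⊆Q t u t≤u)

  ⟪⟫-⊆ : ∀ o (t : Tree X) → (∀ {x} → P x → Q x) → t ∈ o ⟪ P ⟫ → t ∈ o ⟪ Q ⟫
  ⟪⟫-⊆ o t = ⟪⟫-mono o t t (λ p → refl)

  related-refl : {R : REL X X ℓ₁} → (∀ {x} → R x x) → ∀ t → Related R t t
  related-refl r t .transfer o A = ⟪⟫-⊆ o t (λ a → _ , a , r)

  related-mono : {R : REL X Y ℓ₁} {t t′ : Tree X} {u u′ : Tree Y} →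
                 t′ ≤ t → u ≤ u′ → Related R t u → Related R t′ u′
  related-mono {t = t} {t′} {u} {u′} t′≤t u≤u′ h .transfer o A a =
    ⟪⟫-mono o u u′ u≤u′ (λ x → x) (h .transfer o A (⟪⟫-mono o t′ t t′≤t (λ x → x) a))

  related-trans : {R : REL X Y ℓ₁} {R′ : REL Y W ℓ₁} {R″ : REL X W ℓ₁} →
                  (∀ {x y w} → R x y → R′ y w → R″ x w) →
                  ∀ {t u v} → Related R t u → Related R′ u v → Related R″ t v
  related-trans RR′⊆R″ {v = v} h h′ .transfer o A a =
    -- The wildcard is `R ↑ A`: the image under the first relation is the set from which the second
    -- one transfers. The sets in `Related` are predicates at level `ℓ₁` so that such images are
    -- among them.
    ⟪⟫-⊆ o v (λ (y , (x , p , r) , r′) → x , p , RR′⊆R″ r r′) (h′ .transfer o _ (h .transfer o A a))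

  related-⊥ᵀ : {R : REL X Y ℓ₁} (u : Tree Y) → Related R ⊥ᵀ u
  related-⊥ᵀ u .transfer o A = scottOpen o .proj₁ (λ p → bot≤)

  related-leafᵀ : {R : REL X Y ℓ₁} {x : X} {y : Y} → R x y → Related R (leafᵀ x) (leafᵀ y)
  related-leafᵀ {R = R} {x} {y} r .transfer o A = scottOpen o .proj₁ lemma
    where
    lemma : leafᵀ x [∈ A ] ≤ leafᵀ y [∈ R ↑ A ]
    lemma (_ ∷ _) = refl
    lemma []      with em {P = A x} | em {P = (R ↑ A) y}
    ... | yes _ | yes _ = refl
    ... | yes a | no ¬a = contradiction (x , a , r) ¬a
    ... | no _  | _     = bot≤

  related-⨆ : {R : REL X Y ℓ₁} (c : ℕ → Tree X) (mono : IsChain c) {u : Tree Y} →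
              (∀ n → Related R (c n) u) → Related R (⨆ c mono) u
  related-⨆ c mono h .transfer o A a
    with scottOpen o .proj₂ (λ n → c n [∈ A ])
           (λ n → [∈]-mono (λ x → x) (c n) (c (suc n)) (mono n)) _ ([∈]-isSup c mono) a
  ... | n , a′ = h n .transfer o A a′

  -- Restricting `t [∈ A ]` again by `U` changes nothing, and by `∅` forgets `A`. The atomic tests
  -- are therefore transfers at `A` and at the empty set, whose image under `R` is empty.
  related-test : {R : REL X Y ℓ₁} {t : Tree X} {u : Tree Y} → Related R t u →
                 ∀ A → t [∈ A ] ⊴ u [∈ R ↑ A ]
  related-test {t = t} {u} h A (o⊤ o) a =
    resp o (λ p → sym ([∈U]-≈ (u [∈ _ ]) p)) (h .transfer o A (resp o ([∈U]-≈ (t [∈ A ])) a))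
  related-test {R = R} {t} {u} h A (o⊥ o) a =
    resp o (λ p → sym ([∈]-[∈∅] {P = R ↑ A} u p))
      (⟪⟫-⊆ o u (λ (_ , p , _) → lower p)
        (h .transfer o (λ _ → Lift ℓ₁ ⊥) (⟪⟫-⊆ o t lift (resp o ([∈]-[∈∅] {P = A} t) a))))
  related-test h A (⋀ Φ) a       = λ i → related-test h A (Φ i) (a i)
  related-test h A (⋁ Φ) (i , a) = i , related-test h A (Φ i) a

  related-bindᵀ : {X′ Y′ : Set} {R : REL X Y ℓ₁} {R′ : REL X′ Y′ ℓ₁} {t : Tree X} {u : Tree Y}
                  {f : X → Tree X′} {g : Y → Tree Y′} →
                  Related R t u → (∀ {x y} → R x y → Related R′ (f x) (g y)) →
                  Related R′ (bindᵀ t f) (bindᵀ u g)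
  related-bindᵀ {R′ = R′} {t} {u} {f} {g} h k .transfer o A a =
    resp o {bindᵀ u g′} (λ p → sym ([∈]-bindᵀ g u p))
      (resp o ([∈U]-≈ (bindᵀ u g′))
        -- A bind is the flattening of a mapped tree, and the test `o⊤ o` is `o` itself up to
        -- `[∈U]-≈`.
        (decomposable (mapᵀ f′ t) (mapᵀ g′ u) f′t≼g′u (o⊤ o)
          (resp o {bindᵀ t f′} (λ p → sym ([∈U]-≈ (bindᵀ t f′) p))
            (resp o ([∈]-bindᵀ f t) a))))
    where
    f′ = λ x → f x [∈ A ]
    g′ = λ y → g y [∈ R′ ↑ A ]
    f′t≼g′u : mapᵀ f′ t ≼ mapᵀ g′ u
    -- The set transferred from `t` consists of the leaves whose inner trees pass `Φ`; by
    -- `related-test`, the inner trees at related leaves of `u` pass `Φ` as well.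
    f′t≼g′u o Φ b =
      resp o (λ p → sym ([∈]-mapᵀ g′ u p))
        (⟪⟫-⊆ o u (λ (x , lift q , r) → related-test (k r) A Φ q)
          (h .transfer o (λ x → Lift ℓ₁ (f′ x ∈ ⟦ Φ ⟧ᵀ))
            (⟪⟫-⊆ o t lift (resp o ([∈]-mapᵀ f′ t) b))))

  related-nodeᵀ : {R : REL X Y ℓ₁} → ∀ ν {k : Branch ν → Tree X} {k′ : Branch ν → Tree Y} →
                  (∀ b → Related R (k b) (k′ b)) → Related R (nodeᵀ ν k) (nodeᵀ ν k′)
  related-nodeᵀ ν {k} {k′} h =
    related-mono {t = bindᵀ (nodeᵀ ν leafᵀ) k} {u = bindᵀ (nodeᵀ ν leafᵀ) k′}
      (λ p → ≡⇒≤ˢ (sym (bindᵀ-nodeᵀ-leafᵀ ν k p))) (λ p → ≡⇒≤ˢ (bindᵀ-nodeᵀ-leafᵀ ν k′ p))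
      (related-bindᵀ (related-refl {R = λ b b′ → Lift ℓ₁ (b ≡ b′)} (lift refl) (nodeᵀ ν leafᵀ))
        λ { {b} (lift refl) → h b })

  -- Simulations and preservation of formulas.

  record Simulation (R : ClosedRel ℓ₁) : Set (lsuc ℓ₁) where
    field
      N-≡   : {V V′ : Val [] N} → R V V′ → V ≡ V′
      apply : ∀ {τ τ′} {V V′ : Val [] (τ ⇒ τ′)} → R V V′ → ∀ U → R (V · U) (V′ · U)
      ∣∣-related : ∀ {τ} {M M′ : Com [] τ} → R M M′ → Related R ∣ M ∣ ∣ M′ ∣
  open Simulation

  -- By induction on formulas. For a modality the set of leaves satisfying `φ` is transferred, and
  -- its image satisfies `φ` by induction; negation reverses the direction, whence symmetry for
  -- `full`.
  simulation⇒⊑ : (𝓛 : Fragment) {R : ClosedRel ℓ₁} → Simulation R →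
                 (𝓛 ≡ full → ∀ {a τ} {M M′ : Term a [] τ} → R M M′ → R M′ M) →
                 ∀ {a τ} {M M′ : Term a [] τ} → R M M′ → M ⊑[ 𝓛 ] M′
  simulation⇒⊑ 𝓛 {R} sim symmetric = go
    where
    go : ∀ {a τ} {M M′ : Term a [] τ} → R M M′ → M ⊑[ 𝓛 ] M′
    go r ⟨ n ⟩       eq      = trans (sym (sim .N-≡ r)) eq
    go r (V ↦ Φ)     h       = go (sim .apply r V) Φ h
    go {M = M} {M′} r (modal o φ) h =
      ⟪⟫-⊆ o ∣ M′ ∣ (λ (_ , lift h , r) → go r φ h)
        (sim .∣∣-related r .transfer o (λ V → Lift ℓ₁ (V ⊨ φ)) (⟪⟫-⊆ o ∣ M ∣ lift h))
    go r (⋀ φ)       h       = λ i → go r (φ i) (h i)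
    go r (⋁ φ)       (i , h) = i , go r (φ i) h
    go r (neg φ)     h       = λ h′ → h (go (symmetric refl r) φ h′)

  numeral-toℕ : (V : Val [] N) → V ≡ numeral (toℕ V)
  numeral-toℕ Z     = refl
  numeral-toℕ (S V) = cong S (numeral-toℕ V)

  module _ {𝓛 : Fragment} where

    distinguish : ∀ {a τ} (M M′ : Term a [] τ) → ¬ M ⊑[ 𝓛 ] M′ →
                  ∃[ φ ] M ⊨ φ × ¬ M′ ⊨ φ
    distinguish M M′ M⋢M′ with em {P = ∃[ φ ] M ⊨ φ × ¬ M′ ⊨ φ}
    ... | yes d = d
    ... | no ∄d = contradiction (λ φ h → decidable-stable em (λ ¬h′ → ∄d (φ , h , ¬h′))) M⋢M′

    -- Conjunctions must be indexed by small types: one distinguishing formula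
    -- is taken for each of the terms not above M, and `True em` replaces large
    -- propositions by small ones.
    characteristic : ∀ {a τ} → Term a [] τ → Formula 𝓛 a τ
    characteristic M = ⋀ {I = ∃[ M′ ] True (em {P = ¬ M ⊑[ 𝓛 ] M′})} λ (M′ , d) →
      distinguish M M′ (toWitness d) .proj₁

    ⊨-characteristic : ∀ {a τ} (M : Term a [] τ) → M ⊨ characteristic M
    ⊨-characteristic M (M′ , d) = distinguish M M′ (toWitness d) .proj₂ .proj₁

    -- If `M′` were not above `M`, the formula distinguishing `M` from it would be one of the
    -- conjuncts, and `M′` fails that formula.
    characteristic⇒⊑ : ∀ {a τ} (M M′ : Term a [] τ) → M′ ⊨ characteristic M → M ⊑[ 𝓛 ] M′
    characteristic⇒⊑ M M′ h = decidable-stable em λ M⋢M′ →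
      let d = fromWitness M⋢M′ in distinguish M M′ (toWitness d) .proj₂ .proj₂ (h (M′ , d))

    ⊑-simulation : Simulation (BehaviouralPreorder 𝓛)
    ⊑-simulation .N-≡ {V} {V′} V⊑V′ =
      trans (numeral-toℕ V) (sym (V⊑V′ ⟨ toℕ V ⟩ (numeral-toℕ V)))
    ⊑-simulation .apply V⊑V′ U Φ = V⊑V′ (U ↦ Φ)
    ⊑-simulation .∣∣-related {M = M} {M′} M⊑M′ .transfer o A h =
      ⟪⟫-⊆ o ∣ M′ ∣
        (λ {W} ((V , d) , h) → V , toWitness d , characteristic⇒⊑ V W h)
        -- The disjunction of the characteristic formulas of the members of `A` defines the image of
        -- `A`, so one modal formula expresses the transfer. It is free of negation and hence
        -- available in both fragments.
        (M⊑M′ (modal o (⋁ {I = ∃[ V ] True (em {P = A V})} λ (V , _) → characteristic V))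
          (⟪⟫-⊆ o ∣ M ∣ (λ {V} a → (V , fromWitness a) , ⊨-characteristic V) h))

  -- Howe's closure.

  module Closure {R : ClosedRel ℓ₁} (sim : Simulation R)
    (R-refl : ∀ {a τ} {M : Term a [] τ} → R M M)
    (R-trans : ∀ {a τ} {M M′ M″ : Term a [] τ} → R M M′ → R M′ M″ → R M M″) where

    -- The open extension of R, as a record so that M and M′ can be inferred.
    infix 4 _≲_
    record _≲_ {a Γ τ} (M M′ : Term a Γ τ) : Set ℓ₁ where
      constructor closing
      field
        close : (R °) M M′
    open _≲_

    ≲-refl : ∀ {a Γ τ} {M : Term a Γ τ} → M ≲ M
    ≲-refl .close θ = R-refl

    ≲-trans : ∀ {a Γ τ} {M M′ M″ : Term a Γ τ} → M ≲ M′ → M′ ≲ M″ → M ≲ M″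
    ≲-trans r r′ .close θ = R-trans (r .close θ) (r′ .close θ)

    ≲⇒R : ∀ {a τ} {M M′ : Term a [] τ} → M ≲ M′ → R M M′
    ≲⇒R {M = M} {M′} r = subst₂ R (sub-id (λ _ → refl) M) (sub-id (λ _ → refl) M′) (r .close var)

    R⇒≲ : ∀ {a τ} {M M′ : Term a [] τ} → R M M′ → M ≲ M′
    R⇒≲ {M = M} {M′} r .close θ =
      subst₂ R (sym (sub-id (λ ()) M)) (sym (sub-id (λ ()) M′)) r

    ≲-rename : ∀ {a Γ Δ τ} {M M′ : Term a Γ τ} (ρ : Ren Γ Δ) →
               M ≲ M′ → rename ρ M ≲ rename ρ M′
    ≲-rename {M = M} {M′} ρ r .close θ =
      subst₂ R (sym (sub-rename (λ _ → refl) M)) (sym (sub-rename (λ _ → refl) M′))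
        (r .close (λ x → θ (ρ x)))

    ≲-sub : ∀ {a Γ Δ τ} {M M′ : Term a Γ τ} (θ : Sub Γ Δ) →
            M ≲ M′ → sub θ M ≲ sub θ M′
    ≲-sub {M = M} {M′} θ r .close η =
      subst₂ R (sym (sub-sub (λ _ → refl) M)) (sym (sub-sub (λ _ → refl) M′))
        (r .close (λ x → sub η (θ x)))

    infixl 4 _⨾_
    -- The congruence step gives compatibility by construction, and the trailing `≲` absorbs further
    -- steps of the preorder on the right, as in `Howe-R`.
    data Howe : OpenRel ℓ₁ where
      _⨾_ : ∀ {a Γ τ} {M M′ M″ : Term a Γ τ} → Cong Howe M M′ → M′ ≲ M″ → Howe M M″

    congruent : ∀ {a Γ τ} {M M′ : Term a Γ τ} → Cong Howe M M′ → Howe M M′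
    congruent c = c ⨾ ≲-refl

    mutual
      Howe-refl : ∀ {a Γ τ} {M : Term a Γ τ} → Howe M M
      Howe-refl {M = M} = congruent (Cong-refl M)

      Cong-refl : ∀ {a Γ τ} (M : Term a Γ τ) → Cong Howe M M
      Cong-refl ⋆               = ⋆
      Cong-refl Z               = Z
      Cong-refl (S V)           = S Howe-refl
      Cong-refl (ƛ M)           = ƛ Howe-refl
      Cong-refl (var x)         = var x
      Cong-refl (V · W)         = Howe-refl · Howe-refl
      Cong-refl (return V)      = return Howe-refl
      Cong-refl (letin M L)     = letin Howe-refl Howe-refl
      Cong-refl (fix V)         = fix Howe-refl
      Cong-refl (case V M L)    = case Howe-refl Howe-refl Howe-refl
      Cong-refl (opFin σ Ms)    = opFin σ (Howe-refls Ms)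
      Cong-refl (opNFin σ V Ms) = opNFin σ Howe-refl (Howe-refls Ms)
      Cong-refl (opNat σ V)     = opNat σ Howe-refl
      Cong-refl (opNNat σ V W)  = opNNat σ Howe-refl Howe-refl

      Howe-refls : ∀ {a Γ τ n} (Ms : Vec (Term a Γ τ) n) → Pointwise Howe Ms Ms
      Howe-refls []       = []
      Howe-refls (M ∷ Ms) = Howe-refl ∷ Howe-refls Ms

    ≲⇒Howe : ∀ {a Γ τ} {M M′ : Term a Γ τ} → M ≲ M′ → Howe M M′
    ≲⇒Howe {M = M} r = Cong-refl M ⨾ r

    Howe-R : ∀ {a τ} {M M′ M″ : Term a [] τ} → Howe M M′ → R M′ M″ → Howe M M″
    Howe-R (c ⨾ r) r′ = c ⨾ ≲-trans r (R⇒≲ r′)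

    mutual
      Howe-rename : ∀ {a Γ Δ τ} {M M′ : Term a Γ τ} (ρ : Ren Γ Δ) →
                    Howe M M′ → Howe (rename ρ M) (rename ρ M′)
      Howe-rename ρ (c ⨾ r) = Cong-rename ρ c ⨾ ≲-rename ρ r

      Cong-rename : ∀ {a Γ Δ τ} {M M′ : Term a Γ τ} (ρ : Ren Γ Δ) →
                    Cong Howe M M′ → Cong Howe (rename ρ M) (rename ρ M′)
      Cong-rename ρ ⋆               = ⋆
      Cong-rename ρ Z               = Z
      Cong-rename ρ (S h)           = S (Howe-rename ρ h)
      Cong-rename ρ (ƛ h)           = ƛ (Howe-rename (liftRen ρ) h)
      Cong-rename ρ (var x)         = var (ρ x)
      Cong-rename ρ (h · k)         = Howe-rename ρ h · Howe-rename ρ k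
      Cong-rename ρ (return h)      = return (Howe-rename ρ h)
      Cong-rename ρ (letin h k)     = letin (Howe-rename ρ h) (Howe-rename (liftRen ρ) k)
      Cong-rename ρ (fix h)         = fix (Howe-rename ρ h)
      Cong-rename ρ (case h k l)    =
        case (Howe-rename ρ h) (Howe-rename ρ k) (Howe-rename (liftRen ρ) l)
      Cong-rename ρ (opFin σ hs)    = opFin σ (Howe-renames ρ hs)
      Cong-rename ρ (opNFin σ h hs) = opNFin σ (Howe-rename ρ h) (Howe-renames ρ hs)
      Cong-rename ρ (opNat σ h)     = opNat σ (Howe-rename ρ h)
      Cong-rename ρ (opNNat σ h k)  = opNNat σ (Howe-rename ρ h) (Howe-rename ρ k)

      Howe-renames : ∀ {a Γ Δ τ n} {Ms Ms′ : Vec (Term a Γ τ) n} (ρ : Ren Γ Δ) →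
                     Pointwise Howe Ms Ms′ → Pointwise Howe (renames ρ Ms) (renames ρ Ms′)
      Howe-renames ρ []       = []
      Howe-renames ρ (h ∷ hs) = Howe-rename ρ h ∷ Howe-renames ρ hs

    HoweSub : ∀ {Γ Δ} → Sub Γ Δ → Sub Γ Δ → Set ℓ₁
    HoweSub {Γ} θ θ′ = ∀ {τ} (x : Γ ∋ τ) → Howe (θ x) (θ′ x)

    Howe-liftSub : ∀ {Γ Δ τ} {θ θ′ : Sub Γ Δ} → HoweSub θ θ′ →
                   HoweSub (liftSub {τ = τ} θ) (liftSub θ′)
    Howe-liftSub e z     = Howe-refl
    Howe-liftSub e (s x) = Howe-rename s (e x)

    Howe-single : ∀ {Γ τ} {V V′ : Val Γ τ} → Howe V V′ → HoweSub (single V) (single V′)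
    Howe-single h z     = h
    Howe-single h (s x) = Howe-refl

    mutual
      -- The two sides may be substituted differently: the trailing `≲` joins two terms that both
      -- belong to the right side, so it only meets `θ′`.
      Howe-sub : ∀ {a Γ Δ τ} {M M′ : Term a Γ τ} {θ θ′ : Sub Γ Δ} → HoweSub θ θ′ →
                 Howe M M′ → Howe (sub θ M) (sub θ′ M′)
      Howe-sub {θ′ = θ′} e (var x ⨾ r) with e x
      -- The derivation for the substituted value replaces that of the variable, and the two
      -- trailing steps are merged by transitivity.
      ... | c ⨾ r′ = c ⨾ ≲-trans r′ (≲-sub θ′ r)
      Howe-sub {θ′ = θ′} e (⋆ ⨾ r)             = ⋆ ⨾ ≲-sub θ′ r
      Howe-sub {θ′ = θ′} e (Z ⨾ r)             = Z ⨾ ≲-sub θ′ r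
      Howe-sub {θ′ = θ′} e (S h ⨾ r)           = S (Howe-sub e h) ⨾ ≲-sub θ′ r
      Howe-sub {θ′ = θ′} e (ƛ h ⨾ r)           = ƛ (Howe-sub (Howe-liftSub e) h) ⨾ ≲-sub θ′ r
      Howe-sub {θ′ = θ′} e (h · k ⨾ r)         = Howe-sub e h · Howe-sub e k ⨾ ≲-sub θ′ r
      Howe-sub {θ′ = θ′} e (return h ⨾ r)      = return (Howe-sub e h) ⨾ ≲-sub θ′ r
      Howe-sub {θ′ = θ′} e (letin h k ⨾ r)     =
        letin (Howe-sub e h) (Howe-sub (Howe-liftSub e) k) ⨾ ≲-sub θ′ r
      Howe-sub {θ′ = θ′} e (fix h ⨾ r)         = fix (Howe-sub e h) ⨾ ≲-sub θ′ r
      Howe-sub {θ′ = θ′} e (case h k l ⨾ r)    =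
        case (Howe-sub e h) (Howe-sub e k) (Howe-sub (Howe-liftSub e) l) ⨾ ≲-sub θ′ r
      Howe-sub {θ′ = θ′} e (opFin σ hs ⨾ r)    = opFin σ (Howe-subs e hs) ⨾ ≲-sub θ′ r
      Howe-sub {θ′ = θ′} e (opNFin σ h hs ⨾ r) =
        opNFin σ (Howe-sub e h) (Howe-subs e hs) ⨾ ≲-sub θ′ r
      Howe-sub {θ′ = θ′} e (opNat σ h ⨾ r)     = opNat σ (Howe-sub e h) ⨾ ≲-sub θ′ r
      Howe-sub {θ′ = θ′} e (opNNat σ h k ⨾ r)  = opNNat σ (Howe-sub e h) (Howe-sub e k) ⨾ ≲-sub θ′ r

      Howe-subs : ∀ {a Γ Δ τ n} {Ms Ms′ : Vec (Term a Γ τ) n} {θ θ′ : Sub Γ Δ} → HoweSub θ θ′ →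
                  Pointwise Howe Ms Ms′ → Pointwise Howe (subs θ Ms) (subs θ′ Ms′)
      Howe-subs e []       = []
      Howe-subs e (h ∷ hs) = Howe-sub e h ∷ Howe-subs e hs

    Howe-[] : ∀ {a Γ τ τ′} {M M′ : Term a (τ ∷ Γ) τ′} {V V′ : Val Γ τ} →
              Howe M M′ → Howe V V′ → Howe (M [ V ]) (M′ [ V′ ])
    Howe-[] h k = Howe-sub (Howe-single k) h

    Howe-unfold : ∀ {Γ τ τ′} {F F′ : Val Γ ((τ ⇒ τ′) ⇒ (τ ⇒ τ′))} →
                  Howe F F′ → Howe (unfold F) (unfold F′)
    Howe-unfold h = congruent (ƛ (congruent (letin
      (congruent (Howe-rename s h ·
        congruent (ƛ (congruent (letin (congruent (fix (Howe-rename s (Howe-rename s h))))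
                                       Howe-refl)))))
      Howe-refl)))

    Howe-N-≡ : {V V′ : Val [] N} → Howe V V′ → V ≡ V′
    Howe-N-≡ (Z ⨾ r)   = sim .N-≡ (≲⇒R r)
    Howe-N-≡ (S h ⨾ r) = trans (cong S (Howe-N-≡ h)) (sim .N-≡ (≲⇒R r))

    related-∣∣ : ∀ {τ} {t : Tree (Val [] τ)} {M M′ : Com [] τ} →
                 Related Howe t ∣ M ∣ → R M M′ → Related Howe t ∣ M′ ∣
    related-∣∣ h r = related-trans Howe-R h (sim .∣∣-related r)

    related-reduces : ∀ {τ} {t : Tree (Val [] τ)} (M : Com [] τ) {M′ : Com [] τ} →
                      step M ≡ reduces M′ → Related Howe t ∣ M′ ∣ → Related Howe t ∣ M ∣
    related-reduces M eq = related-mono (λ _ → refl) (reduces-≤ M eq)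

    -- In the `letin` case the fuel is the same for the bound computation, whose
    -- derivation is smaller; every call on a derivation obtained by substitution has less fuel.
    mutual
      Howe-approx : ∀ {τ} n {M M′ : Com [] τ} → Howe M M′ → Related Howe (approx M n) ∣ M′ ∣
      Howe-approx n (c ⨾ r) = related-∣∣ (Cong-approx n c) (≲⇒R r)

      Cong-approx : ∀ {τ} n {M M′ : Com [] τ} → Cong Howe M M′ → Related Howe (approx M n) ∣ M′ ∣
      Cong-approx zero c = related-⊥ᵀ _
      Cong-approx (suc n) (_·_ {W′ = W′} (ƛ {M′ = L′} h ⨾ r) k) =
        -- The right-hand function need not be an abstraction syntactically matching the left one.
        -- The reduction is made with the intermediate `ƛ L′`, and `apply` then carries the result
        -- over to the actual function.
        related-∣∣ (related-reduces (ƛ L′ · W′) refl (Howe-approx n (Howe-[] h k)))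
          (sim .apply (≲⇒R r) W′)
      Cong-approx (suc n) (return {V′ = V′} h) =
        related-mono (λ _ → refl) (returns-≤ (return V′) refl) (related-leafᵀ h)
      Cong-approx (suc n) (letin {M = M} {M′} {L} {L′} h k) =
        related-mono (approx-letin-≤ M L n) (bindᵀ-≤-letin M′ L′)
          (related-bindᵀ (Howe-approx (suc n) h) (λ v → Howe-approx n (Howe-[] k v)))
      Cong-approx (suc n) (fix {V′ = F′} h) =
        related-reduces (fix F′) refl (Howe-approx n (congruent (return (Howe-unfold h))))
      -- Related numerals are equal, so both sides select the same branch.
      Cong-approx (suc n) (case {V = Z} {M′ = M′} {L′ = L′} h k l) with Howe-N-≡ h
      ... | refl = related-reduces (case Z M′ L′) refl (Howe-approx n k)
      Cong-approx (suc n) (case {V = S V} {M′ = M′} {L′ = L′} h k l) with Howe-N-≡ h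
      ... | refl = related-reduces (case (S V) M′ L′) refl (Howe-approx n (Howe-[] l Howe-refl))
      Cong-approx (suc n) (opFin σ {Ms′ = Ms′} hs) =
        related-mono (λ _ → refl) (performs-≤ (opFin σ Ms′) refl)
          (related-nodeᵀ (fin σ) λ b → Howe-approx n (Pointwise.lookup hs b))
      Cong-approx (suc n) (opNFin σ {V = V} {Ms′ = Ms′} h hs) with Howe-N-≡ h
      ... | refl = related-mono (λ _ → refl) (performs-≤ (opNFin σ V Ms′) refl)
          (related-nodeᵀ (Nfin σ (toℕ V)) λ b → Howe-approx n (Pointwise.lookup hs b))
      Cong-approx (suc n) (opNat σ {V′ = V′} h) =
        related-mono (λ _ → refl) (performs-≤ (opNat σ V′) refl)
          (related-nodeᵀ (nat σ) λ b → Howe-approx n (congruent (h · Howe-refl)))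
      Cong-approx (suc n) (opNNat σ {V = V} {W′ = W′} h k) with Howe-N-≡ h
      ... | refl = related-mono (λ _ → refl) (performs-≤ (opNNat σ V W′) refl)
          (related-nodeᵀ (Nnat σ (toℕ V)) λ b → Howe-approx n (congruent (k · Howe-refl)))

    Howe-simulation : Simulation Howe
    Howe-simulation .N-≡          = Howe-N-≡
    Howe-simulation .apply h U    = congruent (h · Howe-refl)
    Howe-simulation .∣∣-related {M = M} h =
      related-⨆ (approx M) (approx-chain M) (λ n → Howe-approx n h)

    -- Chains of Howe steps and their symmetry.

    Howe⋆ : OpenRel ℓ₁
    Howe⋆ = Star Howe

    module _ (R-sym : ∀ {a τ} {M M′ : Term a [] τ} → R M M′ → R M′ M) where
      mutual
        -- Reversing a derivation puts its `≲` step before the congruence, whereas `Howe` has it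
        -- after. A chain can accommodate this, starting with the reversed step as a link of its
        -- own.
        Howe⋆-flip : ∀ {a Γ τ} {M M′ : Term a Γ τ} → Howe M M′ → Howe⋆ M′ M
        Howe⋆-flip (c ⨾ r) =
          ≲⇒Howe (closing λ θ → R-sym (r .close θ)) ◅ Star-congruent Howe-refl congruent (Cong-flip c)

        Cong-flip : ∀ {a Γ τ} {M M′ : Term a Γ τ} → Cong Howe M M′ → Cong Howe⋆ M′ M
        Cong-flip ⋆               = ⋆
        Cong-flip Z               = Z
        Cong-flip (S h)           = S (Howe⋆-flip h)
        Cong-flip (ƛ h)           = ƛ (Howe⋆-flip h)
        Cong-flip (var x)         = var x
        Cong-flip (h · k)         = Howe⋆-flip h · Howe⋆-flip k
        Cong-flip (return h)      = return (Howe⋆-flip h)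
        Cong-flip (letin h k)     = letin (Howe⋆-flip h) (Howe⋆-flip k)
        Cong-flip (fix h)         = fix (Howe⋆-flip h)
        Cong-flip (case h k l)    = case (Howe⋆-flip h) (Howe⋆-flip k) (Howe⋆-flip l)
        Cong-flip (opFin σ hs)    = opFin σ (Howe⋆-flips hs)
        Cong-flip (opNFin σ h hs) = opNFin σ (Howe⋆-flip h) (Howe⋆-flips hs)
        Cong-flip (opNat σ h)     = opNat σ (Howe⋆-flip h)
        Cong-flip (opNNat σ h k)  = opNNat σ (Howe⋆-flip h) (Howe⋆-flip k)

        Howe⋆-flips : ∀ {a Γ τ n} {Ms Ms′ : Vec (Term a Γ τ) n} →
                      Pointwise Howe Ms Ms′ → Pointwise Howe⋆ Ms′ Ms
        Howe⋆-flips []       = []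
        Howe⋆-flips (h ∷ hs) = Howe⋆-flip h ∷ Howe⋆-flips hs

      Howe⋆-sym : ∀ {a Γ τ} {M M′ : Term a Γ τ} → Howe⋆ M M′ → Howe⋆ M′ M
      Howe⋆-sym = fold (λ M M′ → Howe⋆ M′ M) (λ h p → p ◅◅ Howe⋆-flip h) ε

  Star-simulation : {R : ClosedRel ℓ₁} → Simulation R → Simulation (Star R)
  Star-simulation sim .N-≡ ε        = refl
  Star-simulation sim .N-≡ (r ◅ rs) = trans (sim .N-≡ r) (Star-simulation sim .N-≡ rs)
  Star-simulation sim .apply rs U   = gmap (_· U) (λ r → sim .apply r U) rs
  Star-simulation sim .∣∣-related ε        = related-refl ε _
  Star-simulation sim .∣∣-related (r ◅ rs) =
    related-trans _◅_ (sim .∣∣-related r) (Star-simulation sim .∣∣-related rs)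

  -- Compatibility of the open extensions.

  module _ (𝓛 : Fragment) where

    private
      ⊑-refl : ∀ {a τ} {M : Term a [] τ} → M ⊑[ 𝓛 ] M
      ⊑-refl φ h = h

      ⊑-trans : ∀ {a τ} {M M′ M″ : Term a [] τ} → M ⊑[ 𝓛 ] M′ → M′ ⊑[ 𝓛 ] M″ → M ⊑[ 𝓛 ] M″
      ⊑-trans p q φ h = q φ (p φ h)

      -- If `M` failed `φ`, it would satisfy `neg φ`, and then so would `M′`.
      ⊑-sym : 𝓛 ≡ full → ∀ {a τ} {M M′ : Term a [] τ} → M ⊑[ 𝓛 ] M′ → M′ ⊑[ 𝓛 ] M
      ⊑-sym refl p φ h = decidable-stable em (λ ¬h → p (neg φ) ¬h h)

    open Closure ⊑-simulation ⊑-refl ⊑-trans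

    Howe⇒⊑ : ∀ {a τ} {M M′ : Term a [] τ} → Howe M M′ → M ⊑[ 𝓛 ] M′
    -- Passing to chains treats both fragments at once; their symmetry is supplied under `𝓛 ≡ full`.
    Howe⇒⊑ h = simulation⇒⊑ 𝓛 (Star-simulation Howe-simulation)
      (λ full → Howe⋆-sym (⊑-sym full)) (h ◅ ε)

    -- The open extension lies inside `Howe`, which is congruent and closed under substitution;
    -- after closing, `Howe⇒⊑` leads back to the preorder.
    ⊑°-congruent : ∀ {a Γ τ} {M M′ : Term a Γ τ} →
                   Cong (BehaviouralPreorder 𝓛 °) M M′ → (BehaviouralPreorder 𝓛 °) M M′
    ⊑°-congruent c θ = Howe⇒⊑ (Howe-sub (λ x → Howe-refl)
      (congruent (Cong-map {R = BehaviouralPreorder 𝓛 °} (λ r → ≲⇒Howe (closing r)) c)))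

    ≡°-congruent : ∀ {a Γ τ} {M M′ : Term a Γ τ} →
                   Cong (BehaviouralEquivalence 𝓛 °) M M′ → (BehaviouralEquivalence 𝓛 °) M M′
    ≡°-congruent c θ =
      ⊑°-congruent
        (Cong-map {R = BehaviouralEquivalence 𝓛 °} {R′ = BehaviouralPreorder 𝓛 °}
          (λ e η → e η .proj₁) c) θ ,
      ⊑°-congruent
        (Cong-sym {R = BehaviouralEquivalence 𝓛 °} {R′ = BehaviouralPreorder 𝓛 °}
          (λ e η → e η .proj₂) c) θ

theorem1 : (em : Classical) (Op : Signature) (𝒪 : Trees.Modalities Op) →
    let open Behaviour em Op 𝒪 in
    Decomposable →
    AllScottOpen →
    Compatible (BehaviouralEquivalence full °) ×
    Compatible (BehaviouralPreorder positive °) ×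
    Compatible (BehaviouralEquivalence positive °)
theorem1 em Op 𝒪 decomposable scottOpen =
  compatible (≡°-congruent full) , compatible (⊑°-congruent positive) ,
  compatible (≡°-congruent positive)
  where
  open Congruence Op
  open HoweMethod em Op 𝒪 decomposable scottOpen
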